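{- For any uncountable analytic family $\mathcal{A}$ of subsets of $E\setminus\{0\}$ (viewed as a subset of $2^{E\setminus\{0\}}$), there are a nonempty perfect $\mathcal{P}\subseteq\mathcal{A}$ and an infinite-dimensional subspace $V$ of $E$ such that either (i) for all $A\in\mathcal{P}$, $V\cap A=\emptyset$, or (ii) for all $A\in\mathcal{P}$, $A$ is asymptotic below $V$.
   Context: $F$ is a countable (possibly finite) field and $E$ is a countably infinite-dimensional $F$-vector space with a fixed basis. Subsets of $E\setminus\{0\}$ are identified with their characteristic functions, points of the Polish space $2^{E\setminus\{0\}}$ with the product topology. For a subset $A\subseteq E\setminus\{0\}$ and an infinite-dimensional subspace $V\subseteq E$, $A$ is asymptotic below $V$ if every infinite-dimensional subspace $W$ of $V$ satisfies $W\cap A\neq\emptyset$. -}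

module Defs where

open import Algebra.Bundles using (CommutativeRing)
open import Algebra.Definitions.RawMonoid using (sum)
open import Algebra.Module.Bundles using (Module)
open import Data.Bool.Base using (Bool; true; false)
open import Data.Fin.Base using (toℕ)
open import Data.List.Base using (List)
open import Data.List.Relation.Unary.All using (All)
open import Data.Nat.Base using (ℕ)
open import Data.Product.Base using (Σ; _×_; proj₁; ∃-syntax)
open import Data.Sum.Base using (_⊎_)
open import Data.Vec.Functional using (Vector; zipWith)
open import Function.Base using (_∘_)
open import Function.Bundles using (Func; _⟨$⟩_; _⇔_)
import Function.Relation.Binary.Setoid.Equality as FuncEquality
open import Level using (Level; _⊔_; suc)
open import Relation.Binary.Bundles using (Setoid)
import Relation.Binary.Construct.On as On
open import Relation.Binary.PropositionalEquality using (_≡_)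
import Relation.Binary.PropositionalEquality as ≡
open import Relation.Nullary.Negation using (¬_)
open import Relation.Unary using (Pred; _∈_; _⊆_; ∁; Empty)

private
  variable
    c ℓ m ℓm i ℓi d j ℓj d′ p : Level

-- At most countable.  The ambient setoid is inhabited in every use, so the
-- empty subset is countable too.
Countable : (S : Setoid c ℓ) → Pred (Setoid.Carrier S) p → Set (c ⊔ ℓ ⊔ p)
Countable S P =
  Σ (ℕ → Setoid.Carrier S) λ f → ∀ x → x ∈ P → ∃[ n ] (Setoid._≈_ S (f n) x)

-- The space Dᴵ with the product topology, D being discrete.
module Product (I : Setoid i ℓi) (D : Set d) where

  Point : Set (i ⊔ ℓi ⊔ d)
  Point = Func I (≡.setoid D)

  pointSetoid : Setoid (i ⊔ ℓi ⊔ d) (i ⊔ d)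
  pointSetoid = FuncEquality.setoid I (≡.setoid D)

  open Setoid pointSetoid public using () renaming (_≈_ to _≈ₚ_)

  -- y lies in the basic neighbourhood of x determined by finitely many
  -- coordinates.
  _≈[_]_ : Point → List (Setoid.Carrier I) → Point → Set (i ⊔ d)
  x ≈[ is ] y = All (λ k → x ⟨$⟩ k ≡ y ⟨$⟩ k) is

  Open : Pred Point p → Set (i ⊔ ℓi ⊔ d ⊔ p)
  Open U = ∀ x → x ∈ U → ∃[ is ] (∀ y → x ≈[ is ] y → y ∈ U)

  Closed : Pred Point p → Set (i ⊔ ℓi ⊔ d ⊔ p)
  Closed P = Open (∁ P)

  Isolated : Pred Point p → Point → Set (i ⊔ ℓi ⊔ d ⊔ p)
  Isolated P x = ∃[ is ] (∀ y → y ∈ P → x ≈[ is ] y → y ≈ₚ x)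

  -- The empty set is perfect in this sense.
  Perfect : Pred Point p → Set (i ⊔ ℓi ⊔ d ⊔ p)
  Perfect P = Closed P × (∀ x → x ∈ P → ¬ Isolated P x)

module _ {I : Setoid i ℓi} {D : Set d} {J : Setoid j ℓj} {D′ : Set d′} where
  private
    module X = Product I D
    module Y = Product J D′

  Continuous : (X.Point → Y.Point) → Set (i ⊔ ℓi ⊔ d ⊔ j ⊔ d′)
  Continuous f =
    ∀ x js → ∃[ is ] (∀ x′ → x X.≈[ is ] x′ → f x Y.≈[ js ] f x′)

module Baire = Product (≡.setoid ℕ) ℕ

-- Being an image is read up to pointwise equality, so P is invariant under it.
Analytic : {I : Setoid i ℓi} {D : Set d} →
           Pred (Product.Point I D) p → Set (i ⊔ ℓi ⊔ d ⊔ p)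
Analytic {I = I} {D = D} P =
  Empty P ⊎
  Σ (Baire.Point → Point) λ f →
    Continuous {I = ≡.setoid ℕ} {D = ℕ} {J = I} {D′ = D} f ×
    (∀ x → x ∈ P ⇔ (∃[ z ] (f z ≈ₚ x)))
  where open Product I D

record IsField (F : CommutativeRing c ℓ) : Set (c ⊔ ℓ) where
  open CommutativeRing F
  field
    1≉0     : ¬ (1# ≈ 0#)
    inverse : ∀ x → ¬ (x ≈ 0#) → ∃[ y ] (x * y ≈ 1#)

module VectorSpace {F : CommutativeRing c ℓ} (E : Module F m ℓm) where
  open CommutativeRing F using (Carrier; _≈_; 0#)
  open Module E

  linearCombination : ∀ {n} → Vector Carrier n → Vector Carrierᴹ n → Carrierᴹ
  linearCombination a b = sum +ᴹ-rawMonoid (zipWith _*ₗ_ a b)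

  -- A basis indexed by ℕ; every finite subset of it is contained in some
  -- initial segment e 0, …, e (n - 1).
  record IsBasis (e : ℕ → Carrierᴹ) : Set (c ⊔ ℓ ⊔ m ⊔ ℓm) where
    field
      spanning    : ∀ v → ∃[ n ] Σ (Vector Carrier n) λ a →
                    linearCombination a (e ∘ toℕ) ≈ᴹ v
      independent : ∀ n (a : Vector Carrier n) →
                    linearCombination a (e ∘ toℕ) ≈ᴹ 0ᴹ → ∀ k → a k ≈ 0#

  record IsSubspace (V : Pred Carrierᴹ p) : Set (c ⊔ m ⊔ ℓm ⊔ p) where
    field
      resp : ∀ {u v} → u ≈ᴹ v → u ∈ V → v ∈ V
      0∈   : 0ᴹ ∈ V
      +∈   : ∀ {u v} → u ∈ V → v ∈ V → (u +ᴹ v) ∈ V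
      *∈   : ∀ a {v} → v ∈ V → (a *ₗ v) ∈ V

  FiniteDimensional : Pred Carrierᴹ p → Set (c ⊔ m ⊔ ℓm ⊔ p)
  FiniteDimensional V =
    ∃[ n ] Σ (Vector Carrierᴹ n) λ b →
      (∀ k → b k ∈ V) ×
      (∀ v → v ∈ V → Σ (Vector Carrier n) λ a → linearCombination a b ≈ᴹ v)

  record IsInfiniteDimensionalSubspace (V : Pred Carrierᴹ p)
         : Set (c ⊔ m ⊔ ℓm ⊔ p) where
    field
      isSubspace          : IsSubspace V
      infiniteDimensional : ¬ FiniteDimensional V

  -- A Point over E∖0 is the characteristic function of a subset of E∖0; being
  -- a setoid function, it respects the equality of E.
  E∖0 : Setoid (m ⊔ ℓm) ℓm
  E∖0 = On.setoid {B = Σ Carrierᴹ λ v → ¬ (v ≈ᴹ 0ᴹ)} ≈ᴹ-setoid proj₁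

  open Product E∖0 Bool public

  Disjoint : Pred Carrierᴹ p → Point → Set (m ⊔ ℓm ⊔ p)
  Disjoint V A = ∀ (v : Setoid.Carrier E∖0) → proj₁ v ∈ V → A ⟨$⟩ v ≡ false

  Meets : Pred Carrierᴹ p → Point → Set (m ⊔ ℓm ⊔ p)
  Meets V A = Σ (Setoid.Carrier E∖0) λ v → (proj₁ v ∈ V) × (A ⟨$⟩ v ≡ true)

  -- Excluded middle makes every predicate equivalent to one at any level, so
  -- taking W at the level of V loses no subspaces.
  AsymptoticBelow : Point → Pred Carrierᴹ p → Set (c ⊔ m ⊔ ℓm ⊔ suc p)
  AsymptoticBelow {p = p} A V =
    (W : Pred Carrierᴹ p) → IsInfiniteDimensionalSubspace W → W ⊆ V → Meets W A

{-# OPTIONS --safe #-}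

-- Pass to a perfect subset of 𝒜.  For a finite-dimensional X, a subspace V and
-- a perfect P, either V and P have a further V′ and P′ such that no W ⊆ V′ and
-- A ∈ P′ satisfy A ∩ (X + W) = ∅, or no such V′ and P′ exist.  There are
-- countably many X, so a fusion produces one V and one P such that near each
-- A ∈ P this alternative has been decided for every X, with V itself in the
-- first case.  If the first case occurs for X = 0, then A is asymptotic below V
-- for all A in a relatively open perfect part of P.  If the second occurs, then
-- it persists: finitely many parts of P have members avoiding X + W for a common
-- W ⊆ V; any w ∈ W ∖ X makes the first case impossible for X + Fw near these
-- members.  So a Cantor scheme in P is built along with vectors whose span its
-- body avoids.

module Submission where

open import Algebra.Bundles using (CommutativeMonoid; CommutativeRing)
open import Algebra.Module.Bundles using (Module)
import Algebra.Properties.CommutativeSemigroup as CommutativeSemigroup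
import Algebra.Properties.Monoid.Sum as MonoidSum
import Algebra.Properties.Ring as RingProperties
open import Axiom.ExcludedMiddle using (ExcludedMiddle)
open import Data.Bool.Base using (Bool; true; false; not)
open import Data.Empty using (⊥)
import Data.Fin.Base as Fin
open Fin using (toℕ; fromℕ<)
import Data.Fin.Properties as Fin
open import Data.List.Base as List using (List; []; _∷_; applyDownFrom; applyUpTo)
open import Data.List.Membership.Propositional using () renaming (_∈_ to _∈ₗ_)
open import Data.List.Membership.Propositional.Properties using (∈-applyDownFrom⁺; ∈-lookup; ∈-tabulate⁺)
import Data.List.Properties as List
open import Data.List.Relation.Unary.All as All using (All; []; _∷_)
import Data.List.Relation.Unary.All.Properties as All
open import Data.List.Relation.Unary.Any using (here; there)
open import Data.Nat.Base using (ℕ; zero; suc; _+_; _⊔_; _≤_; _<_; _≤′_; z≤n; s≤s; ≤′-refl; ≤′-step)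
open import Data.Nat.Properties
open import Data.Product.Base using (Σ; _×_; _,_; proj₁; proj₂; ∃-syntax)
open import Data.Sum.Base as Sum using (_⊎_; inj₁; inj₂; [_,_]′)
open import Data.Unit.Base using (tt)
open import Data.Vec.Base using (Vec; []; _∷_)
open import Data.Vec.Functional using (Vector)
open import Function.Base using (_∘_; id)
open import Function.Bundles using (Equivalence; Func; _⟨$⟩_)
open import Level using (Level; Lift; lift; lower; 0ℓ) renaming (_⊔_ to _⊔ˡ_; suc to sucˡ)
open import Relation.Binary.Bundles using (Setoid)
open import Relation.Binary.PropositionalEquality as ≡ using (_≡_; refl; sym; trans; cong; cong₂; subst)
import Relation.Binary.Reasoning.Setoid as SetoidReasoning
open import Relation.Nullary.Decidable using (Dec; yes; no; True; decidable-stable; fromWitness; toWitness)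
open import Relation.Nullary.Negation using (¬_; contradiction)
open import Relation.Unary using (Pred; _∈_; _⊆_; U; Satisfiable)
open import Defs

private
  variable
    c d i ℓ ℓi μ ℓμ p q q′ : Level

-- Codes for pairs and finite sequences, and nodes of the binary tree.

private
  diagonalStep : ℕ × ℕ → ℕ × ℕ
  diagonalStep (zero  , b) = suc b , zero
  diagonalStep (suc a , b) = a , suc b

unpair : ℕ → ℕ × ℕ
unpair zero    = zero , zero
unpair (suc n) = diagonalStep (unpair n)

-- `unpair` walks along the antidiagonals: `(a , suc b)` comes right after `(suc a , b)`, and
-- `(suc a , zero)` right after `(zero , a)`. Hence the induction on the sum and, within it, on `b`.
unpair-surjective : ∀ a b → ∃[ n ] unpair n ≡ (a , b)
unpair-surjective a b = go (a + b) b a refl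
  where
  go : ∀ s b a → a + b ≡ s → ∃[ n ] unpair n ≡ (a , b)
  go s       (suc b) a       eq with go s b (suc a) (trans (sym (+-suc a b)) eq)
  ... | n , eqₙ = suc n , cong diagonalStep eqₙ
  go zero    zero    zero    eq = zero , refl
  go (suc s) zero    (suc a) eq
    with go s a zero (suc-injective (trans (cong suc (sym (+-identityʳ a))) eq))
  ... | n , eqₙ = suc n , cong diagonalStep eqₙ

-- A number codes an infinite sequence whose initial segments can be prescribed. This serves for
-- lists, for coefficients and for a countable dense set in Baire space.
unpairSequence : ℕ → ℕ → ℕ
unpairSequence k zero    = proj₁ (unpair k)
unpairSequence k (suc i) = unpairSequence (proj₂ (unpair k)) i

unpairSequence-surjective : ∀ {l} (a : Vector ℕ l) →
                            ∃[ k ] (∀ i → unpairSequence k (toℕ i) ≡ a i)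
unpairSequence-surjective {zero}  a = zero , λ ()
unpairSequence-surjective {suc l} a
  with unpairSequence-surjective (a ∘ Fin.suc)
... | k , eqₖ with unpair-surjective (a Fin.zero) k
... | n , eqₙ = n , λ where
  Fin.zero    → cong proj₁ eqₙ
  (Fin.suc i) → trans (cong (λ u → unpairSequence (proj₂ u) (toℕ i)) eqₙ) (eqₖ i)

private
  initialSegment : ℕ × ℕ → List ℕ
  initialSegment (l , k) = List.tabulate {n = l} (unpairSequence k ∘ toℕ)

unpairList : ℕ → List ℕ
unpairList = initialSegment ∘ unpair

unpairList-surjective : ∀ is → ∃[ n ] unpairList n ≡ is
unpairList-surjective is with unpairSequence-surjective (List.lookup is)
... | k , eqₖ with unpair-surjective (List.length is) k
... | n , eqₙ = n , trans (cong initialSegment eqₙ)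
                      (trans (List.tabulate-cong eqₖ) (List.tabulate-lookup is))

all<⇒bounded : ∀ {A : Set ℓ} (f : A → ℕ) xs → ∃[ n ] All (λ x → f x < n) xs
all<⇒bounded f []       = zero , []
all<⇒bounded f (x ∷ xs) with all<⇒bounded f xs
... | n , fxs<n = suc (f x) ⊔ n
                , m≤m⊔n _ n ∷ All.map (λ fy<n → ≤-trans fy<n (m≤n⊔m (suc (f x)) n)) fxs<n

-- `≤′` grows at its upper end, just as nodes grow at the head.
ancestor : ∀ {m n} → m ≤′ n → Vec Bool n → Vec Bool m
ancestor ≤′-refl       t       = t
ancestor (≤′-step m≤n) (_ ∷ t) = ancestor m≤n t

trues : ∀ {n} m → Vec Bool n → Vec Bool (m + n)
trues zero    t = t
trues (suc m) t = true ∷ trues m t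

-- Neighbourhoods, perfect sets and Cantor schemes.

-- The points of Dᴵ for an index setoid enumerated by idx, with the
-- neighbourhoods of a point determined by the first N coordinates.
module Enumerated (I : Setoid i ℓi) (D : Set d) (idx : ℕ → Setoid.Carrier I)
                  (idx-onto : ∀ k → ∃[ n ] (Setoid._≈_ I (idx n) k)) where
  open Product I D

  # : Setoid.Carrier I → ℕ
  # k = proj₁ (idx-onto k)

  infix 4 _≈⟨_⟩_
  -- A record, so that the points and the bound can be inferred from a proof.
  record _≈⟨_⟩_ (x : Point) (N : ℕ) (y : Point) : Set d where
    constructor agree
    field at : ∀ j → j < N → x ⟨$⟩ idx j ≡ y ⟨$⟩ idx j

  open _≈⟨_⟩_ public

  ≈⟨⟩-refl : ∀ {N x} → x ≈⟨ N ⟩ x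
  ≈⟨⟩-refl = agree λ _ _ → refl

  ≈⟨⟩-sym : ∀ {N x y} → x ≈⟨ N ⟩ y → y ≈⟨ N ⟩ x
  ≈⟨⟩-sym x≈y = agree λ j j<N → sym (at x≈y j j<N)

  ≈⟨⟩-trans : ∀ {N x y z} → x ≈⟨ N ⟩ y → y ≈⟨ N ⟩ z → x ≈⟨ N ⟩ z
  ≈⟨⟩-trans x≈y y≈z = agree λ j j<N → trans (at x≈y j j<N) (at y≈z j j<N)

  ≈⟨⟩-mono : ∀ {M N x y} → M ≤ N → x ≈⟨ N ⟩ y → x ≈⟨ M ⟩ y
  ≈⟨⟩-mono M≤N x≈y = agree λ j j<M → at x≈y j (≤-trans j<M M≤N)

  ≡-at : ∀ {x y : Point} k → x ⟨$⟩ idx (# k) ≡ y ⟨$⟩ idx (# k) → x ⟨$⟩ k ≡ y ⟨$⟩ k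
  ≡-at {x} {y} k eq =
    trans (sym (Func.cong x (proj₂ (idx-onto k))))
      (trans eq (Func.cong y (proj₂ (idx-onto k))))

  ≈⟨⟩⇒≡ : ∀ {N x y} k → # k < N → x ≈⟨ N ⟩ y → x ⟨$⟩ k ≡ y ⟨$⟩ k
  ≈⟨⟩⇒≡ {x = x} {y} k #k<N x≈y = ≡-at {x} {y} k (at x≈y (# k) #k<N)

  ≈[]⇒≈⟨⟩ : ∀ {N x y} → x ≈[ applyUpTo idx N ] y → x ≈⟨ N ⟩ y
  ≈[]⇒≈⟨⟩ {N} x≈y = agree λ j j<N → All.applyUpTo⁻ idx N x≈y j<N

  ≈⟨⟩⇒≈[] : ∀ is → ∃[ N ] (∀ {x y} → x ≈⟨ N ⟩ y → x ≈[ is ] y)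
  ≈⟨⟩⇒≈[] is with all<⇒bounded # is
  ... | N , is<N = N , λ x≈y → All.map (λ {k} k<N → ≈⟨⟩⇒≡ k k<N x≈y) is<N

  -- A positive form of perfectness: closed under limits, and every neighbourhood of a member
  -- contains another member, with a coordinate that tells them apart.
  record NonemptyPerfect (P : Pred Point p) : Set (i ⊔ˡ ℓi ⊔ˡ d ⊔ˡ p) where
    field
      centre   : Point
      centre∈  : centre ∈ P
      closed   : ∀ x → (∀ N → ∃[ y ] (y ∈ P × x ≈⟨ N ⟩ y)) → x ∈ P
      crowded  : ∀ x → x ∈ P → ∀ N →
                 ∃[ y ] (y ∈ P × x ≈⟨ N ⟩ y ×
                         ∃[ j ] (¬ (x ⟨$⟩ idx j ≡ y ⟨$⟩ idx j)))

  infixl 6 _∩[_,_]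
  _∩[_,_] : Pred Point p → Point → ℕ → Pred Point (d ⊔ˡ p)
  (P ∩[ x , N ]) y = y ∈ P × x ≈⟨ N ⟩ y

  -- Basic neighbourhoods are clopen: approximating to precision `N` tests membership, and a new
  -- member found to precision `M ⊔ N` stays inside.
  ∩-perfect : ∀ {P : Pred Point p} → NonemptyPerfect P →
              ∀ {x} → x ∈ P → ∀ N → NonemptyPerfect (P ∩[ x , N ])
  ∩-perfect perf {x} x∈P N = record
    { centre  = x
    ; centre∈ = x∈P , ≈⟨⟩-refl
    ; closed  = λ y lim → closed y (λ M → let z , (z∈P , _) , y≈z = lim M in z , z∈P , y≈z)
                        , (let z , (_ , x≈z) , y≈z = lim N in ≈⟨⟩-trans x≈z (≈⟨⟩-sym y≈z))
    ; crowded = λ y (y∈P , x≈y) M →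
        let z , z∈P , y≈z , y≉z = crowded y y∈P (M ⊔ N)
        in z , (z∈P , ≈⟨⟩-trans x≈y (≈⟨⟩-mono (m≤n⊔m M N) y≈z))
             , ≈⟨⟩-mono (m≤m⊔n M N) y≈z , y≉z
    }
    where open NonemptyPerfect perf

  nonemptyPerfect-≐ : ∀ {P : Pred Point p} {Q : Pred Point q} → P ⊆ Q → Q ⊆ P →
                      NonemptyPerfect P → NonemptyPerfect Q
  nonemptyPerfect-≐ P⊆Q Q⊆P perf = record
    { centre  = centre
    ; centre∈ = P⊆Q centre∈
    ; closed  = λ x lim → P⊆Q (closed x λ N → let y , y∈ , x≈y = lim N in y , Q⊆P y∈ , x≈y)
    ; crowded = λ x x∈ N → let y , y∈ , apart = crowded x (Q⊆P x∈) N in y , P⊆Q y∈ , apart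
    }
    where open NonemptyPerfect perf

  Splitting : Pred Point p → Set (i ⊔ˡ ℓi ⊔ˡ d ⊔ˡ p)
  Splitting P = Σ (Bool → Point) λ ys → (∀ b → ys b ∈ P) ×
                ∃[ j ] (¬ (ys true ⟨$⟩ idx j ≡ ys false ⟨$⟩ idx j))

  perfect-splits : ∀ {P : Pred Point p} → NonemptyPerfect P → Splitting P
  perfect-splits perf with crowded centre centre∈ 0
    where open NonemptyPerfect perf
  ... | y , y∈ , _ , apart =
    (λ { true → centre ; false → y }) , (λ { true → centre∈ ; false → y∈ }) , apart
    where open NonemptyPerfect perf

  -- Nodes of the binary tree are Boolean vectors whose head is the last
  -- branching.
  record CantorScheme : Set (i ⊔ˡ ℓi ⊔ˡ d) where
    field
      centre  : ∀ {n} → Vec Bool n → Point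
      depth   : ∀ {n} → Vec Bool n → ℕ
      deepens : ∀ {n} b (t : Vec Bool n) → depth t < depth (b ∷ t)
      refines : ∀ {n} b (t : Vec Bool n) → centre t ≈⟨ depth t ⟩ centre (b ∷ t)
      splits  : ∀ {n} (t : Vec Bool n) →
                ∃[ j ] ((∀ b → j < depth (b ∷ t)) ×
                        ¬ (centre (true ∷ t) ⟨$⟩ idx j ≡ centre (false ∷ t) ⟨$⟩ idx j))

    Cell : ∀ {n} → Vec Bool n → Pred Point d
    Cell t y = centre t ≈⟨ depth t ⟩ y

    -- The nodes are chosen separately at each level; by `cell-unique` they still form a branch.
    Body : Pred Point d
    Body y = ∀ n → Σ (Vec Bool n) λ t → y ∈ Cell t

    n≤depth : ∀ {n} (t : Vec Bool n) → n ≤ depth t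
    n≤depth []      = z≤n
    n≤depth (b ∷ t) = ≤-trans (s≤s (n≤depth t)) (deepens b t)

    cell-tail : ∀ {n b} {t : Vec Bool n} {y} → y ∈ Cell (b ∷ t) → y ∈ Cell t
    cell-tail {b = b} {t} y∈ =
      ≈⟨⟩-trans (refines b t) (≈⟨⟩-mono (<⇒≤ (deepens b t)) y∈)

    cell-ancestor : ∀ {m n} (m≤n : m ≤′ n) {t : Vec Bool n} {y} →
                    y ∈ Cell t → y ∈ Cell (ancestor m≤n t)
    cell-ancestor ≤′-refl       y∈ = y∈
    cell-ancestor (≤′-step m≤n) {b ∷ t} y∈ = cell-ancestor m≤n (cell-tail y∈)

    cell-trues : ∀ {n j k} (t : Vec Bool n) → j ≤′ k → ∀ {y} →
                 y ∈ Cell (trues k t) → y ∈ Cell (trues j t)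
    cell-trues t ≤′-refl       y∈ = y∈
    cell-trues t (≤′-step j≤k) y∈ = cell-trues t j≤k (cell-tail y∈)

    children-disjoint : ∀ {n} (t : Vec Bool n) {y} →
                        y ∈ Cell (true ∷ t) → ¬ (y ∈ Cell (false ∷ t))
    children-disjoint t y∈₁ y∈₂ =
      let j , j< , ≢ = splits t in
      ≢ (trans (at y∈₁ j (j< true)) (sym (at y∈₂ j (j< false))))

    cell-unique : ∀ {n} {t u : Vec Bool n} {y} → y ∈ Cell t → y ∈ Cell u → t ≡ u
    cell-unique {t = []}    {[]}    y∈t y∈u = refl
    cell-unique {t = a ∷ t} {b ∷ u} y∈t y∈u
      with cell-unique {t = t} {u} (cell-tail y∈t) (cell-tail y∈u)
    cell-unique {t = true  ∷ t} {true  ∷ _} y∈t y∈u | refl = refl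
    cell-unique {t = false ∷ t} {false ∷ _} y∈t y∈u | refl = refl
    cell-unique {t = true  ∷ t} {false ∷ _} y∈t y∈u | refl =
      contradiction y∈u (children-disjoint t y∈t)
    cell-unique {t = false ∷ t} {true  ∷ _} y∈t y∈u | refl =
      contradiction y∈t (children-disjoint t y∈u)

    -- This carries closed conditions from the centres below `t` to the body. Nodes of level `N + n`
    -- have depth at least `N`, and by `cell-unique` the one containing `y` descends from `t`.
    approximate : ∀ {n} {t : Vec Bool n} {y} → y ∈ Body → y ∈ Cell t → ∀ N →
                  ∃[ m ] Σ (n ≤′ m) λ n≤m → Σ (Vec Bool m) λ u →
                  ancestor n≤m u ≡ t × y ≈⟨ N ⟩ centre u
    approximate {n} y∈Body y∈t N with y∈Body (N + n)
    ... | u , y∈u =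
      N + n , n≤m , u , cell-unique (cell-ancestor n≤m y∈u) y∈t
            , ≈⟨⟩-sym (≈⟨⟩-mono (≤-trans (m≤m+n N n) (n≤depth u)) y∈u)
      where n≤m = ≤⇒≤′ (m≤n+m n N)

    module _ {n} (t : Vec Bool n) where
      private
        value : ℕ → Setoid.Carrier I → D
        value j k = centre (trues j t) ⟨$⟩ k

        value-stable : ∀ {j k} → j ≤ k → ∀ {l} → l < depth (trues j t) →
                       value j (idx l) ≡ value k (idx l)
        value-stable j≤k l<N = at (cell-trues t (≤⇒≤′ j≤k) ≈⟨⟩-refl) _ l<N

        #<depth : ∀ k → # k < depth (trues (suc (# k)) t)
        #<depth k = ≤-trans (m≤m+n (suc (# k)) n) (n≤depth (trues (suc (# k)) t))

        value-eventual : ∀ {j} k → suc (# k) ≤ j → value (suc (# k)) k ≡ value j k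
        value-eventual {j} k #k<j =
          ≡-at {centre (trues (suc (# k)) t)} {centre (trues j t)} k
            (value-stable #k<j (#<depth k))

      -- The point at the end of the all-`true` branch below `t`. At stage `suc (# k)` the depth
      -- exceeds `# k`, so the value at `k` is final.
      limit : Point
      limit = record
        { to   = λ k → value (suc (# k)) k
        -- Equal indices may have different numbers, so both values are moved to a stage beyond
        -- either number.
        ; cong = λ {k} {l} k≈l →
            trans (value-eventual k (m≤m⊔n _ (suc (# l))))
              (trans (Func.cong (centre (trues (suc (# k) ⊔ suc (# l)) t)) k≈l)
                (sym (value-eventual l (m≤n⊔m (suc (# k)) _))))
        }

      limit∈trues : ∀ j → limit ∈ Cell (trues j t)
      limit∈trues j = agree λ l l<N →
        let m = # (idx l) in
        trans (value-stable (m≤m⊔n j (suc m)) l<N)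
          (sym (value-eventual (idx l) (m≤n⊔m j (suc m))))

      limit∈Body : limit ∈ Body
      limit∈Body m = ancestor (≤⇒≤′ (m≤m+n m n)) (trues m t)
                   , cell-ancestor (≤⇒≤′ (m≤m+n m n)) (limit∈trues m)

    private
      sibling-apart : ∀ {n} b (t : Vec Bool n) {x y} →
                      x ∈ Cell (b ∷ t) → y ∈ Cell (not b ∷ t) →
                      ∃[ j ] (¬ (x ⟨$⟩ idx j ≡ y ⟨$⟩ idx j))
      sibling-apart true t x∈ y∈ =
        let j , j< , ≢ = splits t in
        j , λ eq → ≢ (trans (at x∈ j (j< true)) (trans eq (sym (at y∈ j (j< false)))))
      sibling-apart false t x∈ y∈ =
        let j , j< , ≢ = splits t in
        j , λ eq → ≢ (trans (at y∈ j (j< true)) (trans (sym eq) (sym (at x∈ j (j< false)))))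

      -- Turn the other way at the last branching of the node of `x` on level `suc N`. The new point
      -- shares the parent cell with `x`, of depth at least `N`, but lies in the disjoint sibling
      -- cell.
      crowded : ∀ x → x ∈ Body → ∀ N →
                ∃[ y ] (y ∈ Body × x ≈⟨ N ⟩ y × ∃[ j ] (¬ (x ⟨$⟩ idx j ≡ y ⟨$⟩ idx j)))
      crowded x x∈ N with x∈ (suc N)
      ... | b ∷ t , x∈bt =
        limit t′ , limit∈Body t′
        , ≈⟨⟩-mono (n≤depth t) (≈⟨⟩-trans (≈⟨⟩-sym (cell-tail x∈bt)) (cell-tail (limit∈trues t′ 0)))
        , sibling-apart b t x∈bt (limit∈trues t′ 0)
        where t′ = not b ∷ t

      -- Induction on the level. A point of the body that agrees with `x` up to the depths of both
      -- children of `t` has `t` as its node, so it lies in one of these children, and `x` lies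
      -- there too.
      closed : ∀ x → (∀ N → ∃[ y ] (y ∈ Body × x ≈⟨ N ⟩ y)) → x ∈ Body
      closed x lim zero with lim (depth [])
      ... | y , y∈ , x≈y with y∈ 0
      ... | [] , y∈[] = [] , ≈⟨⟩-trans y∈[] (≈⟨⟩-sym x≈y)
      closed x lim (suc n) with closed x lim n
      ... | t , x∈t with lim (depth (true ∷ t) ⊔ depth (false ∷ t))
      ... | y , y∈ , x≈y with y∈ (suc n)
      ... | b ∷ u , y∈bu
        with cell-unique {t = t} {u}
               (≈⟨⟩-trans x∈t (≈⟨⟩-mono (≤-trans (<⇒≤ (deepens true t)) (m≤m⊔n _ _)) x≈y))
               (cell-tail y∈bu)
      ... | refl = b ∷ t , ≈⟨⟩-trans y∈bu (≈⟨⟩-mono (deep b) (≈⟨⟩-sym x≈y))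
        where
        deep : ∀ b → depth (b ∷ t) ≤ depth (true ∷ t) ⊔ depth (false ∷ t)
        deep true  = m≤m⊔n _ _
        deep false = m≤n⊔m (depth (true ∷ t)) _

    body-perfect : NonemptyPerfect Body
    body-perfect = record
      { centre  = limit []
      ; centre∈ = limit∈Body []
      ; closed  = closed
      ; crowded = crowded
      }

-- Classical perfectness and the perfect set theorem.

module Classical (em : ∀ {k} → ExcludedMiddle k) where

  dne : ∀ {A : Set ℓ} → ¬ ¬ A → A
  dne = decidable-stable em

  module _ {I : Setoid i ℓi} {D : Set d} {idx : ℕ → Setoid.Carrier I}
           (idx-onto : ∀ k → ∃[ n ] (Setoid._≈_ I (idx n) k)) where
    open Product I D
    open Enumerated I D idx idx-onto

    nonemptyPerfect⇒perfect : ∀ {P : Pred Point p} → NonemptyPerfect P → Perfect P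
    nonemptyPerfect⇒perfect {P = P} perf = open-complement , not-isolated
      where
      open NonemptyPerfect perf

      open-complement : Closed P
      open-complement x x∉P with em {P = ∃[ N ] (∀ y → x ≈⟨ N ⟩ y → ¬ y ∈ P)}
      ... | yes (N , away) = applyUpTo idx N , λ y x≈y → away y (≈[]⇒≈⟨⟩ x≈y)
      ... | no  near = contradiction
        (closed x λ N → dne λ none → near (N , λ y x≈y y∈P → none (y , y∈P , x≈y))) x∉P

      not-isolated : ∀ x → x ∈ P → ¬ Isolated P x
      not-isolated x x∈P (is , unique) with ≈⟨⟩⇒≈[] is
      ... | N , refine with crowded x x∈P N
      ... | y , y∈P , x≈y , j , x≢y = x≢y (sym (unique y y∈P (refine x≈y) (idx j)))

    -- The perfect set theorem: a Cantor scheme of condensation points.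
    module PerfectSet (f : Baire.Point → Point)
                      (f-continuous : Continuous {I = ≡.setoid ℕ} {J = I} f)
                      (f-uncountable : ¬ (Σ (ℕ → Point) λ g → ∀ z → ∃[ n ] (g n ≈ₚ f z))) where
      private
        module ℕᴺ = Enumerated (≡.setoid ℕ) ℕ id (λ n → n , refl)

        continuity : ∀ z M → ∃[ n ] (∀ {z′} → z ℕᴺ.≈⟨ n ⟩ z′ → f z ≈⟨ M ⟩ f z′)
        continuity z M with f-continuous z (applyUpTo idx M)
        ... | is , refine with ℕᴺ.≈⟨⟩⇒≈[] is
        ... | n , refine′ = n , λ {z′} z≈z′ → ≈[]⇒≈⟨⟩ (refine z′ (refine′ z≈z′))

        Small : Baire.Point → ℕ → Set _
        Small z n = Σ (ℕ → Point) λ g → ∀ z′ → z ℕᴺ.≈⟨ n ⟩ z′ → ∃[ m ] (g m ≈ₚ f z′)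

        -- Condensation points, measured by images: every neighbourhood has uncountable image under
        -- `f`.
        Kernel : Pred Baire.Point _
        Kernel z = ∀ n → ¬ Small z n

        decode : ℕ → Baire.Point
        decode k = record { to = unpairSequence k ; cong = cong (unpairSequence k) }

        decode-dense : ∀ z n → ∃[ k ] (decode k ℕᴺ.≈⟨ n ⟩ z)
        decode-dense z n with unpairSequence-surjective {n} (λ j → z ⟨$⟩ toℕ j)
        ... | k , eq = k , ℕᴺ.agree λ j j<n →
          subst (λ l → unpairSequence k l ≡ z ⟨$⟩ l) (Fin.toℕ-fromℕ< j<n) (eq (fromℕ< j<n))

        KernelSplitting : Baire.Point → ℕ → Set _
        KernelSplitting z n = Σ (Bool → Baire.Point) λ zs →
          (∀ b → zs b ∈ Kernel) × (∀ b → z ℕᴺ.≈⟨ n ⟩ zs b) ×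
          ∃[ j ] (¬ (f (zs true) ⟨$⟩ idx j ≡ f (zs false) ⟨$⟩ idx j))

        module _ z n (unsplit : ¬ KernelSplitting z n) where
          anyKernel : Dec (∃[ z′ ] (z′ ∈ Kernel × z ℕᴺ.≈⟨ n ⟩ z′)) → Point
          anyKernel (yes (z′ , _)) = f z′
          -- A default value, for the case that there is nothing to cover.
          anyKernel (no _)         = f z

          anyKernel-covers : ∀ dec z′ → z′ ∈ Kernel → z ℕᴺ.≈⟨ n ⟩ z′ → anyKernel dec ≈ₚ f z′
          anyKernel-covers (yes (y , y∈ , z≈y)) z′ z′∈ z≈z′ k = ≡-at {f y} {f z′} k
            (dne λ ≢ → unsplit ( (λ { true → y ; false → z′ }) , (λ { true → y∈ ; false → z′∈ })
                               , (λ { true → z≈y ; false → z≈z′ }) , # k , ≢ ))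
          anyKernel-covers (no none) z′ z′∈ z≈z′ = contradiction (z′ , z′∈ , z≈z′) none

          anySmall : ∀ {y m} → Dec (Small y m) → ℕ → Point
          anySmall (yes (g , _)) r = g r
          anySmall (no _)        r = f z

          anySmall-covers : ∀ {y m} (dec : Dec (Small y m)) → Small y m → ∀ z′ →
                            y ℕᴺ.≈⟨ m ⟩ z′ → ∃[ r ] (anySmall dec r ≈ₚ f z′)
          anySmall-covers (yes (g , covers)) _ z′ y≈z′ = covers z′ y≈z′
          anySmall-covers (no big) small = contradiction small big

          smallPiece : ℕ × ℕ → ℕ → Point
          smallPiece (m , k) = anySmall (em {P = Small (decode k) m})

          piece : ℕ × ℕ → Point
          piece (zero  , _) = anyKernel em
          piece (suc q , r) = smallPiece (unpair q) r

          -- Without a splitting, `f` is constant on the kernel points near `z`, so one point covers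
          -- their images. Every other point lies in a small neighbourhood of some `decode k`; there
          -- are countably many of these, each with countable image.
          unsplit⇒small : Small z n
          unsplit⇒small = piece ∘ unpair , covers
            where
            covers : ∀ z′ → z ℕᴺ.≈⟨ n ⟩ z′ → ∃[ m ] (piece (unpair m) ≈ₚ f z′)
            covers z′ z≈z′ with em {P = z′ ∈ Kernel}
            ... | yes z′∈ = 0 , anyKernel-covers em z′ z′∈ z≈z′
            ... | no  z′∉ with dne {A = ∃[ m ] Small z′ m} (λ none → z′∉ λ m small → none (m , small))
            ... | m , g , g-covers with decode-dense z′ m
            ... | k , k≈z′
              -- `decode k` and `z′` have the same neighbourhood of radius `m`, so the smallness
              -- found at `z′` holds at `decode k`.
              with anySmall-covers em
                     (g , λ y k≈y → g-covers y (ℕᴺ.≈⟨⟩-trans (ℕᴺ.≈⟨⟩-sym k≈z′) k≈y)) z′ k≈z′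
                 | unpair-surjective m k
            ... | r , hit | q , eq-q with unpair-surjective (suc q) r
            ... | s , eq-s = s , subst (λ u → piece u ≈ₚ f z′) (sym eq-s)
                                   (subst (λ u → smallPiece u r ≈ₚ f z′) (sym eq-q) hit)

        split : ∀ z n → ¬ Small z n → KernelSplitting z n
        split z n big = dne λ unsplit → big (unsplit⇒small z n unsplit)

        -- A node carries a neighbourhood in Baire space that `f` maps into its cell, so that points
        -- of the body can be traced back to arguments of `f`.
        record Node : Set (i ⊔ˡ ℓi ⊔ˡ d) where
          field
            stem    : Baire.Point
            stem∈   : stem ∈ Kernel
            radius  : ℕ
            depth   : ℕ
            decides : ∀ {z} → stem ℕᴺ.≈⟨ radius ⟩ z → f stem ≈⟨ depth ⟩ f z

        -- Splitting the whole space, whose image is uncountable, supplies a first kernel point.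
        root : Node
        root with split (decode 0) 0
                    (λ (g , covers) → f-uncountable (g , λ z → covers z (ℕᴺ.agree λ _ ())))
        ... | zs , zs∈ , _ = record
          { stem    = zs true
          ; stem∈   = zs∈ true
          ; radius  = 0
          ; depth   = 0
          ; decides = λ _ → agree λ _ ()
          }

        module _ (s : Node) where
          open Node s

          splitting : KernelSplitting stem radius
          splitting = split stem radius (stem∈ radius)

          -- It lies beyond the coordinate that separates the images of the two stems, so the cells
          -- of the children are disjoint.
          childDepth : ℕ
          childDepth = suc (depth ⊔ proj₁ (proj₂ (proj₂ (proj₂ splitting))))

          child : Bool → Node
          child b = record
            { stem    = proj₁ splitting b
            ; stem∈   = proj₁ (proj₂ splitting) b
            -- The first bound makes the stems converge along branches, the second makes the image
            -- fit into the cell.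
            ; radius  = suc radius ⊔ proj₁ cont
            ; depth   = childDepth
            ; decides = λ z≈ → proj₂ cont (ℕᴺ.≈⟨⟩-mono (m≤n⊔m (suc radius) _) z≈)
            }
            where cont = continuity (proj₁ splitting b) childDepth

          radius<child : ∀ b → radius < Node.radius (child b)
          radius<child b = m≤m⊔n (suc radius) (proj₁ (continuity (proj₁ splitting b) childDepth))

        node : ∀ {n} → Vec Bool n → Node
        node []      = root
        node (b ∷ t) = child (node t) b

        open module N {n} (t : Vec Bool n) = Node (node t)

        stem-refines : ∀ {n} b (t : Vec Bool n) → stem t ℕᴺ.≈⟨ radius t ⟩ stem (b ∷ t)
        stem-refines b t = proj₁ (proj₂ (proj₂ (splitting (node t)))) b

        scheme : CantorScheme
        scheme = record
          { centre  = f ∘ stem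
          ; depth   = depth
          ; deepens = λ b t → s≤s (m≤m⊔n (depth t) _)
          ; refines = λ b t → decides t (stem-refines b t)
          ; splits  = λ t → let j , ≢ = proj₂ (proj₂ (proj₂ (splitting (node t)))) in
                            j , (λ b → s≤s (m≤n⊔m (depth t) j)) , ≢
          }

        module S = CantorScheme scheme

        n≤radius : ∀ {n} (t : Vec Bool n) → n ≤ radius t
        n≤radius []      = z≤n
        n≤radius (b ∷ t) = ≤-trans (s≤s (n≤radius t)) (radius<child (node t) b)

        stem-ancestor : ∀ {m n} (m≤n : m ≤′ n) (t : Vec Bool n) →
                        stem (ancestor m≤n t) ℕᴺ.≈⟨ m ⟩ stem t
        stem-ancestor ≤′-refl       t       = ℕᴺ.≈⟨⟩-refl
        stem-ancestor {n = suc n} (≤′-step m≤n) (b ∷ t) =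
          ℕᴺ.≈⟨⟩-trans (stem-ancestor m≤n t)
            (ℕᴺ.≈⟨⟩-mono (≤-trans (≤′⇒≤ m≤n) (n≤radius t)) (stem-refines b t))

        module _ {y} (y∈ : y ∈ S.Body) where
          branch : ∀ n → Vec Bool n
          branch n = proj₁ (y∈ n)

          -- The limit of the stems along the branch of `y`: from level `suc j` on, coordinate `j`
          -- has settled.
          source : Baire.Point
          source = record { to = λ j → stem (branch (suc j)) ⟨$⟩ j
                          ; cong = cong (λ j → stem (branch (suc j)) ⟨$⟩ j) }

          source≈stem : ∀ m → source ℕᴺ.≈⟨ m ⟩ stem (branch m)
          source≈stem m = ℕᴺ.agree λ j j<m →
            trans (cong (λ t → stem t ⟨$⟩ j)
                    (S.cell-unique {t = branch (suc j)} {ancestor (≤⇒≤′ j<m) (branch m)}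
                      (proj₂ (y∈ (suc j)))
                      (S.cell-ancestor (≤⇒≤′ j<m) {branch m} (proj₂ (y∈ m)))))
                  (ℕᴺ.at (stem-ancestor (≤⇒≤′ j<m) (branch m)) j ≤-refl)

          -- Take a level beyond `# k` and beyond the modulus of continuity at `source`. There the
          -- image of the stem agrees at `k` with `f source` by continuity, and with `y` because `y`
          -- is in the cell.
          f-source : f source ≈ₚ y
          f-source k with continuity source (suc (# k))
          ... | n , decides = ≈⟨⟩⇒≡ k ≤-refl (≈⟨⟩-trans
            (decides (ℕᴺ.≈⟨⟩-mono (m≤m⊔n n _) (source≈stem m)))
            (≈⟨⟩-mono (≤-trans (m≤n⊔m n _) (S.n≤depth (branch m))) (proj₂ (y∈ m))))
            where m = n ⊔ suc (# k)

      perfectSubset : Σ (Pred Point d) λ P → NonemptyPerfect P × (∀ y → y ∈ P → ∃[ z ] (f z ≈ₚ y))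
      perfectSubset = S.Body , S.body-perfect , λ y y∈ → source y∈ , f-source y∈

  -- Excluded middle yields propositional resizing; this puts spans at the level `p` required of
  -- subspaces.
  Resized : ∀ p → Set ℓ → Set p
  Resized p A = Lift p (True (em {P = A}))

  resize : ∀ {A : Set ℓ} → A → Resized p A
  resize a = lift (fromWitness a)

  unresize : ∀ {A : Set ℓ} → Resized p A → A
  unresize r = toWitness (lower r)

  -- Spans and infinite-dimensional subspaces.

  module LinearAlgebra {F : CommutativeRing c ℓ} (isField : IsField F) (E : Module F μ ℓμ) where
    open CommutativeRing F
      using (Carrier; _≈_; 0#; 1#; -_; setoid; ring)
      renaming (_+_ to _+ᶠ_; _*_ to _*ᶠ_)
    module F = CommutativeRing F
    open IsField isField
    open Module E
    open VectorSpace E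
    open IsSubspace
    open IsInfiniteDimensionalSubspace

    data Span (S : Pred Carrierᴹ p) : Pred Carrierᴹ (c ⊔ˡ μ ⊔ˡ ℓμ ⊔ˡ p) where
      generator : ∀ {v} → S v → Span S v
      zeroᴹ     : Span S 0ᴹ
      add       : ∀ {u v} → Span S u → Span S v → Span S (u +ᴹ v)
      scale     : ∀ a {v} → Span S v → Span S (a *ₗ v)
      respects  : ∀ {u v} → u ≈ᴹ v → Span S u → Span S v

    infixr 6 _∪ᵍ_
    _∪ᵍ_ : List Carrierᴹ → Pred Carrierᴹ p → Pred Carrierᴹ (μ ⊔ˡ p)
    (ws ∪ᵍ S) v = v ∈ₗ ws ⊎ S v

    span-isSubspace : (S : Pred Carrierᴹ p) → IsSubspace (Span S)
    span-isSubspace S = record { resp = respects ; 0∈ = zeroᴹ ; +∈ = add ; *∈ = scale }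

    span-least : ∀ {S : Pred Carrierᴹ p} {V : Pred Carrierᴹ q} →
                 IsSubspace V → S ⊆ V → Span S ⊆ V
    span-least V S⊆V (generator s)  = S⊆V s
    span-least V S⊆V zeroᴹ          = 0∈ V
    span-least V S⊆V (add u v)      = +∈ V (span-least V S⊆V u) (span-least V S⊆V v)
    span-least V S⊆V (scale a v)    = *∈ V a (span-least V S⊆V v)
    span-least V S⊆V (respects e v) = resp V e (span-least V S⊆V v)

    span-mono : ∀ {S : Pred Carrierᴹ p} {T : Pred Carrierᴹ q} → S ⊆ T → Span S ⊆ Span T
    span-mono {T = T} S⊆T = span-least (span-isSubspace T) (λ s → generator (S⊆T s))

    +ᴹ-interchange : ∀ u v x y → (u +ᴹ v) +ᴹ (x +ᴹ y) ≈ᴹ (u +ᴹ x) +ᴹ (v +ᴹ y)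
    +ᴹ-interchange = CommutativeSemigroup.interchange
      (CommutativeMonoid.commutativeSemigroup +ᴹ-commutativeMonoid)

    span-split : ∀ {w} {S : Pred Carrierᴹ p} {x} → x ∈ Span (λ v → v ≡ w ⊎ S v) →
                 ∃[ a ] ∃[ u ] (u ∈ Span S × x ≈ᴹ a *ₗ w +ᴹ u)
    span-split {w = w} (generator (inj₁ refl)) = 1# , 0ᴹ , zeroᴹ ,
      ≈ᴹ-sym (≈ᴹ-trans (+ᴹ-identityʳ _) (*ₗ-identityˡ w))
    span-split {w = w} {x = x} (generator (inj₂ s)) = 0# , x , generator s ,
      ≈ᴹ-sym (≈ᴹ-trans (+ᴹ-cong (*ₗ-zeroˡ w) ≈ᴹ-refl) (+ᴹ-identityˡ x))
    span-split {w = w} zeroᴹ = 0# , 0ᴹ , zeroᴹ ,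
      ≈ᴹ-sym (≈ᴹ-trans (+ᴹ-identityʳ _) (*ₗ-zeroˡ w))
    span-split {w = w} (add x∈ y∈) with span-split x∈ | span-split y∈
    ... | a , u , u∈ , x≈ | b , v , v∈ , y≈ = a +ᶠ b , u +ᴹ v , add u∈ v∈ ,
      ≈ᴹ-trans (+ᴹ-cong x≈ y≈)
        (≈ᴹ-trans (+ᴹ-interchange _ _ _ _) (+ᴹ-cong (≈ᴹ-sym (*ₗ-distribʳ w a b)) ≈ᴹ-refl))
    span-split {w = w} (scale r x∈) with span-split x∈
    ... | a , u , u∈ , x≈ = r *ᶠ a , r *ₗ u , scale r u∈ ,
      ≈ᴹ-trans (*ₗ-congˡ x≈)
        (≈ᴹ-trans (*ₗ-distribˡ r _ u) (+ᴹ-cong (≈ᴹ-sym (*ₗ-assoc r a w)) ≈ᴹ-refl))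
    span-split (respects x≈y x∈) with span-split x∈
    ... | a , u , u∈ , x≈ = a , u , u∈ , ≈ᴹ-trans (≈ᴹ-sym x≈y) x≈

    span-∷-split : ∀ {w ws x} → x ∈ Span (_∈ₗ w ∷ ws) →
                   ∃[ a ] ∃[ u ] (u ∈ Span (_∈ₗ ws) × x ≈ᴹ a *ₗ w +ᴹ u)
    span-∷-split x∈ = span-split (span-mono (λ { (here eq) → inj₁ eq ; (there i) → inj₂ i }) x∈)

    ∈-∷⇒ : ∀ {w ws} {S : Pred Carrierᴹ p} → (w ∷ ws) ∪ᵍ S ⊆ (λ v → v ≡ w ⊎ (ws ∪ᵍ S) v)
    ∈-∷⇒ (inj₁ (here eq))  = inj₁ eq
    ∈-∷⇒ (inj₁ (there v∈)) = inj₂ (inj₁ v∈)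
    ∈-∷⇒ (inj₂ s)          = inj₂ (inj₂ s)

    span-coefficients : ∀ bs {x} → x ∈ Span (_∈ₗ bs) →
                        Σ (Vector Carrier (List.length bs)) λ a →
                        linearCombination a (List.lookup bs) ≈ᴹ x
    span-coefficients [] {x} x∈ = (λ ()) , ≈ᴹ-sym (span-least zero-isSubspace (λ ()) x∈)
      where
      zero-isSubspace : IsSubspace (_≈ᴹ 0ᴹ)
      zero-isSubspace = record
        { resp = λ u≈v u≈0 → ≈ᴹ-trans (≈ᴹ-sym u≈v) u≈0
        ; 0∈ = ≈ᴹ-refl
        ; +∈ = λ u≈0 v≈0 → ≈ᴹ-trans (+ᴹ-cong u≈0 v≈0) (+ᴹ-identityˡ 0ᴹ)
        ; *∈ = λ a v≈0 → ≈ᴹ-trans (*ₗ-congˡ v≈0) (*ₗ-zeroʳ a) }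
    span-coefficients (b ∷ bs) x∈ with span-∷-split x∈
    ... | r , u , u∈ , x≈ with span-coefficients bs u∈
    ... | a , a≈u = (λ { Fin.zero → r ; (Fin.suc k) → a k })
                  , ≈ᴹ-trans (+ᴹ-cong ≈ᴹ-refl a≈u) (≈ᴹ-sym x≈)

    combination∈span : ∀ {S : Pred Carrierᴹ p} {n} (a : Vector Carrier n) b →
                       (∀ k → b k ∈ S) → linearCombination a b ∈ Span S
    combination∈span {n = zero}  a b b∈ = zeroᴹ
    combination∈span {n = suc n} a b b∈ =
      add (scale _ (generator (b∈ Fin.zero))) (combination∈span _ _ (b∈ ∘ Fin.suc))

    finitelySpanned⇒finiteDimensional : ∀ {V : Pred Carrierᴹ p} bs → All V bs →
                                        V ⊆ Span (_∈ₗ bs) → FiniteDimensional V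
    finitelySpanned⇒finiteDimensional bs bs∈ V⊆ =
      List.length bs , List.lookup bs , (λ k → All.lookup bs∈ (∈-lookup k))
      , λ v v∈ → span-coefficients bs (V⊆ v∈)

    finiteDimensional⇒finitelySpanned : ∀ {V : Pred Carrierᴹ p} → FiniteDimensional V →
                                        ∃[ bs ] (All V bs × V ⊆ Span (_∈ₗ bs))
    finiteDimensional⇒finitelySpanned (n , b , b∈ , spans) =
      List.tabulate b , All.tabulate⁺ b∈ , λ {v} v∈ → let a , a≈v = spans v v∈ in
      respects a≈v (combination∈span a b (∈-tabulate⁺))

    infiniteDimensional-≐ : ∀ {V : Pred Carrierᴹ p} {W : Pred Carrierᴹ q} → V ⊆ W → W ⊆ V →
                            IsInfiniteDimensionalSubspace V → IsInfiniteDimensionalSubspace W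
    infiniteDimensional-≐ V⊆W W⊆V V∞ = record
      { isSubspace = record
        { resp = λ u≈v u∈ → V⊆W (resp V (u≈v) (W⊆V u∈))
        ; 0∈ = V⊆W (0∈ V)
        ; +∈ = λ u∈ v∈ → V⊆W (+∈ V (W⊆V u∈) (W⊆V v∈))
        ; *∈ = λ a v∈ → V⊆W (*∈ V a (W⊆V v∈))
        }
      ; infiniteDimensional = λ (n , b , b∈ , spans) →
          infiniteDimensional V∞ (n , b , W⊆V ∘ b∈ , λ v v∈ → spans v (V⊆W v∈))
      }
      where V = isSubspace V∞

    infixl 7 _∩ᵛ_
    _∩ᵛ_ : Pred Carrierᴹ p → Pred Carrierᴹ q → Pred Carrierᴹ (p ⊔ˡ q)
    (V ∩ᵛ W) v = v ∈ V × v ∈ W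

    ∩-isSubspace : ∀ {V : Pred Carrierᴹ p} {W : Pred Carrierᴹ q} →
                   IsSubspace V → IsSubspace W → IsSubspace (V ∩ᵛ W)
    ∩-isSubspace V W = record
      { resp = λ u≈v (u∈V , u∈W) → resp V u≈v u∈V , resp W u≈v u∈W
      ; 0∈ = 0∈ V , 0∈ W
      ; +∈ = λ (u∈V , u∈W) (v∈V , v∈W) → +∈ V u∈V v∈V , +∈ W u∈W v∈W
      ; *∈ = λ a (v∈V , v∈W) → *∈ V a v∈V , *∈ W a v∈W
      }

    *ₗ-cancel : ∀ r v → (- r) *ₗ v +ᴹ r *ₗ v ≈ᴹ 0ᴹ
    *ₗ-cancel r v = begin
      (- r) *ₗ v +ᴹ r *ₗ v ≈⟨ *ₗ-distribʳ v (- r) r ⟨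
      (- r +ᶠ r) *ₗ v      ≈⟨ *ₗ-congʳ (F.-‿inverseˡ r) ⟩
      0# *ₗ v              ≈⟨ *ₗ-zeroˡ v ⟩
      0ᴹ                   ∎
      where open SetoidReasoning ≈ᴹ-setoid

    -- Subtracting a multiple of one vector of W outside U moves W into U.
    ∩-infiniteDimensional₁ :
      ∀ {W : Pred Carrierᴹ p} {U : Pred Carrierᴹ q} w →
      IsInfiniteDimensionalSubspace W → IsSubspace U →
      W ⊆ Span (λ v → v ≡ w ⊎ U v) → IsInfiniteDimensionalSubspace (W ∩ᵛ U)
    ∩-infiniteDimensional₁ {W = W} {U} w W∞ Uₛ W⊆ = record
      { isSubspace = ∩-isSubspace Wₛ Uₛ
      ; infiniteDimensional = infinite
      }
      where
      Wₛ = isSubspace W∞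

      infinite : ¬ FiniteDimensional (W ∩ᵛ U)
      infinite fd with finiteDimensional⇒finitelySpanned fd | em {P = ∃[ x ] (x ∈ W × ¬ x ∈ U)}
      ... | bs , bs∈ , spans | no W⊆U = infiniteDimensional W∞
        (finitelySpanned⇒finiteDimensional bs (All.map proj₁ bs∈)
          λ {x} x∈ → spans (x∈ , dne λ x∉ → W⊆U (x , x∈ , x∉)))
      ... | bs , bs∈ , spans | yes (x , x∈W , x∉U) with span-split (W⊆ x∈W)
      ... | a , u , u∈ , x≈ with inverse a a≉0
        where
        u∈U = span-least Uₛ id u∈
        a≉0 : ¬ a ≈ 0#
        a≉0 a≈0 = x∉U (resp Uₛ (≈ᴹ-sym (≈ᴹ-trans x≈ (≈ᴹ-trans
          (+ᴹ-cong (≈ᴹ-trans (*ₗ-congʳ a≈0) (*ₗ-zeroˡ w)) ≈ᴹ-refl) (+ᴹ-identityˡ u)))) u∈U)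
      ... | a⁻¹ , aa⁻¹≈1 = infiniteDimensional W∞
        (finitelySpanned⇒finiteDimensional (x ∷ bs) (x∈W ∷ All.map proj₁ bs∈) W⊆x∷bs)
        where
        W⊆x∷bs : W ⊆ Span (_∈ₗ x ∷ bs)
        W⊆x∷bs {y} y∈W with span-split (W⊆ y∈W)
        ... | b , v , v∈ , y≈ = respects y′+rx≈y
          (add (span-mono there (spans (y′∈W , y′∈U))) (scale r (generator (here refl))))
          where
          open SetoidReasoning ≈ᴹ-setoid
          -- As `x = a w + u` and `y = b w + v`, this multiple of `x` cancels the `w`-component of
          -- `y`.
          r = b *ᶠ a⁻¹
          y′ = y +ᴹ (- r) *ₗ x

          y′∈W : y′ ∈ W
          y′∈W = +∈ Wₛ y∈W (*∈ Wₛ (- r) x∈W)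

          -ra≈-b : (- r) *ᶠ a ≈ - b
          -ra≈-b = F.trans (F.sym (RingProperties.-‿distribˡ-* ring r a))
            (F.-‿cong (F.trans (F.*-assoc b a⁻¹ a)
              (F.trans (F.*-congˡ (F.trans (F.*-comm a⁻¹ a) aa⁻¹≈1)) (F.*-identityʳ b))))

          y′∈U : y′ ∈ U
          y′∈U = resp Uₛ (≈ᴹ-sym (begin
            y +ᴹ (- r) *ₗ x
              ≈⟨ +ᴹ-cong y≈ (≈ᴹ-trans (*ₗ-congˡ x≈) (*ₗ-distribˡ (- r) (a *ₗ w) u)) ⟩
            (b *ₗ w +ᴹ v) +ᴹ ((- r) *ₗ a *ₗ w +ᴹ (- r) *ₗ u)
              ≈⟨ +ᴹ-interchange _ _ _ _ ⟩
            (b *ₗ w +ᴹ (- r) *ₗ a *ₗ w) +ᴹ (v +ᴹ (- r) *ₗ u)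
              ≈⟨ +ᴹ-cong (+ᴹ-cong ≈ᴹ-refl
                   (≈ᴹ-trans (≈ᴹ-sym (*ₗ-assoc (- r) a w)) (*ₗ-congʳ -ra≈-b))) ≈ᴹ-refl ⟩
            (b *ₗ w +ᴹ (- b) *ₗ w) +ᴹ (v +ᴹ (- r) *ₗ u)
              ≈⟨ +ᴹ-cong (≈ᴹ-trans (+ᴹ-comm _ _) (*ₗ-cancel b w)) ≈ᴹ-refl ⟩
            0ᴹ +ᴹ (v +ᴹ (- r) *ₗ u)
              ≈⟨ +ᴹ-identityˡ _ ⟩
            v +ᴹ (- r) *ₗ u ∎))
            (+∈ Uₛ (span-least Uₛ id v∈) (*∈ Uₛ (- r) (span-least Uₛ id u∈)))

          y′+rx≈y : y′ +ᴹ r *ₗ x ≈ᴹ y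
          y′+rx≈y = ≈ᴹ-trans (+ᴹ-assoc y _ _)
            (≈ᴹ-trans (+ᴹ-cong ≈ᴹ-refl (*ₗ-cancel r x)) (+ᴹ-identityʳ y))

    -- `U` has finite codimension relative to `W`. The extra generators go one at a time: intersect
    -- first with the span of the remaining ones and `U`.
    ∩-infiniteDimensional :
      ∀ ws {W : Pred Carrierᴹ p} {U : Pred Carrierᴹ q} →
      IsInfiniteDimensionalSubspace W → IsSubspace U →
      W ⊆ Span (ws ∪ᵍ U) → IsInfiniteDimensionalSubspace (W ∩ᵛ U)
    ∩-infiniteDimensional [] W∞ Uₛ W⊆ =
      infiniteDimensional-≐ (λ x∈ → x∈ , span-least Uₛ (λ { (inj₂ u∈) → u∈ }) (W⊆ x∈)) proj₁ W∞
    ∩-infiniteDimensional (w ∷ ws) {U = U} W∞ Uₛ W⊆ =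
      infiniteDimensional-≐ (λ ((x∈W , _) , x∈U) → x∈W , x∈U)
        (λ (x∈W , x∈U) → (x∈W , generator (inj₂ x∈U)) , x∈U)
        (∩-infiniteDimensional ws
          (∩-infiniteDimensional₁ w W∞ (span-isSubspace (ws ∪ᵍ U))
            (λ x∈ → span-mono (λ v∈ → [ inj₁ , inj₂ ∘ generator ]′ (∈-∷⇒ {S = U} v∈)) (W⊆ x∈)))
          Uₛ proj₂)

    -- If `W` were inside the span of `ws`, its intersection with the zero space, written as the
    -- span of the empty set, would still be infinite-dimensional.
    escape : ∀ {W : Pred Carrierᴹ p} → IsInfiniteDimensionalSubspace W → ∀ ws →
             ∃[ w ] (w ∈ W × ¬ w ∈ Span (_∈ₗ ws))
    escape W∞ ws = dne λ none → infiniteDimensional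
      (∩-infiniteDimensional ws W∞ (span-isSubspace {p = ℓμ} (λ _ → Lift ℓμ ⊥))
        (λ {w} w∈ → span-mono inj₁ (dne λ w∉ → none (w , w∈ , w∉))))
      (finitelySpanned⇒finiteDimensional [] [] λ (_ , x∈) → span-mono (λ ()) x∈)

    Below : (ℕ → Carrierᴹ) → ℕ → Pred Carrierᴹ _
    Below w n v = ∃[ i ] (i < n × v ≡ w i)

    below-mono : ∀ w {k n} → k ≤ n → Span (Below w k) ⊆ Span (Below w n)
    below-mono w k≤n = span-mono λ (i , i<k , eq) → i , ≤-trans i<k k≤n , eq

    span-range-compact : ∀ w {v} → v ∈ Span (λ v → ∃[ n ] v ≡ w n) → ∃[ n ] v ∈ Span (Below w n)
    span-range-compact w (generator (n , eq)) = suc n , generator (n , ≤-refl , eq)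
    span-range-compact w zeroᴹ                = 0 , zeroᴹ
    span-range-compact w (add u∈ v∈) with span-range-compact w u∈ | span-range-compact w v∈
    ... | k , u∈ₖ | n , v∈ₙ =
      k ⊔ n , add (below-mono w (m≤m⊔n k n) u∈ₖ) (below-mono w (m≤n⊔m k n) v∈ₙ)
    span-range-compact w (scale a v∈) =
      let n , v∈ₙ = span-range-compact w v∈ in n , scale a v∈ₙ
    span-range-compact w (respects u≈v u∈) =
      let n , u∈ₙ = span-range-compact w u∈ in n , respects u≈v u∈ₙ

    span-range-compact-All : ∀ w {bs} → All (_∈ Span (λ v → ∃[ n ] v ≡ w n)) bs →
                             ∃[ n ] All (_∈ Span (Below w n)) bs
    span-range-compact-All w []         = 0 , []
    span-range-compact-All w (b∈ ∷ bs∈) with span-range-compact w b∈ | span-range-compact-All w bs∈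
    ... | k , b∈ₖ | n , bs∈ₙ =
      k ⊔ n , below-mono w (m≤m⊔n k n) b∈ₖ ∷ All.map (below-mono w (m≤n⊔m k n)) bs∈ₙ

    -- A finite spanning set involves only the `w i` with `i < n` for some `n`. These lie in the
    -- span of `ws n`, which misses `w n`.
    independent⇒infiniteDimensional :
      ∀ (w : ℕ → Carrierᴹ) (ws : ℕ → List Carrierᴹ) →
      (∀ {i n} → i < n → w i ∈ₗ ws n) → (∀ n → ¬ w n ∈ Span (_∈ₗ ws n)) →
      IsInfiniteDimensionalSubspace (Span (λ v → ∃[ n ] v ≡ w n))
    independent⇒infiniteDimensional w ws w∈ws w∉ = record
      { isSubspace = span-isSubspace _
      ; infiniteDimensional = λ fd →
          let bs , bs∈ , spans = finiteDimensional⇒finitelySpanned fd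
              n , bs⊆ = span-range-compact-All w bs∈
          in w∉ n (span-least (span-isSubspace _)
                    (λ b∈ → span-mono (λ { (i , i<n , refl) → w∈ws i<n }) (All.lookup bs⊆ b∈))
                    (spans (generator (n , refl))))
      }

    -- Initial segments of the basis, and an enumeration of the vectors.

    module _ {e : ℕ → Carrierᴹ} (basis : IsBasis e) where
      open IsBasis basis

      -- `sum` unfolds at the first term, whereas initial segments of the basis grow at the last.
      combination-last : ∀ n (a : ℕ → Carrier) →
        linearCombination {suc n} (a ∘ toℕ) (e ∘ toℕ) ≈ᴹ
        linearCombination {n} (a ∘ toℕ) (e ∘ toℕ) +ᴹ a n *ₗ e n
      combination-last n a = begin
        sum t
          ≈⟨ MonoidSum.sum-init-last +ᴹ-monoid t ⟩
        sum (λ k → t (Fin.inject₁ k)) +ᴹ t (Fin.fromℕ n)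
          ≡⟨ cong₂ _+ᴹ_ (MonoidSum.sum-cong-≗ +ᴹ-monoid {n} (cong term ∘ Fin.toℕ-inject₁))
                        (cong term (Fin.toℕ-fromℕ n)) ⟩
        linearCombination {n} (a ∘ toℕ) (e ∘ toℕ) +ᴹ a n *ₗ e n ∎
        where
        open SetoidReasoning ≈ᴹ-setoid
        sum = MonoidSum.sum +ᴹ-monoid
        term : ℕ → Carrierᴹ
        term k = a k *ₗ e k
        t : Vector Carrierᴹ (suc n)
        t k = term (toℕ k)

      -- Coefficients are indexed by all of `ℕ`, so that lengthening a combination changes a single
      -- value.
      extend : ∀ n → (ℕ → Carrier) → Carrier → ℕ → Carrier
      extend n a r k with k ≟ n
      ... | yes _ = r
      ... | no  _ = a k

      extend-≡ : ∀ n a r → extend n a r n ≡ r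
      extend-≡ n a r with n ≟ n
      ... | yes _   = refl
      ... | no  n≢n = contradiction refl n≢n

      extend-< : ∀ {n k} a r → k < n → extend n a r k ≡ a k
      extend-< {n} {k} a r k<n with k ≟ n
      ... | yes refl = contradiction k<n (<-irrefl refl)
      ... | no  _    = refl

      combination-extend : ∀ n a r →
        linearCombination {suc n} (extend n a r ∘ toℕ) (e ∘ toℕ) ≈ᴹ
        linearCombination {n} (a ∘ toℕ) (e ∘ toℕ) +ᴹ r *ₗ e n
      combination-extend n a r = ≈ᴹ-trans (combination-last n (extend n a r)) (≈ᴹ-reflexive
        (cong₂ _+ᴹ_
          (MonoidSum.sum-cong-≗ +ᴹ-monoid {n} λ k → cong (_*ₗ e (toℕ k)) (extend-< a r (Fin.toℕ<n k)))
          (cong (_*ₗ e n) (extend-≡ n a r))))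

      initial-coefficients : ∀ n {x} → x ∈ Span (_∈ₗ applyDownFrom e n) →
        Σ (ℕ → Carrier) λ a → linearCombination {n} (a ∘ toℕ) (e ∘ toℕ) ≈ᴹ x
      initial-coefficients zero    x∈ = (λ _ → 0#) , proj₂ (span-coefficients [] x∈)
      initial-coefficients (suc n) x∈ with span-∷-split x∈
      ... | r , u , u∈ , x≈ with initial-coefficients n u∈
      ... | a , a≈u = extend n a r , ≈ᴹ-trans (combination-extend n a r)
        (≈ᴹ-trans (+ᴹ-cong a≈u ≈ᴹ-refl) (≈ᴹ-trans (+ᴹ-comm _ _) (≈ᴹ-sym x≈)))

      -- Otherwise there is a linear relation in which `e n` has coefficient `-1`; independence
      -- gives `-1 = 0`, hence `1 = 0`.
      basis∉initial : ∀ n → ¬ e n ∈ Span (_∈ₗ applyDownFrom e n)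
      basis∉initial n eₙ∈ with initial-coefficients n eₙ∈
      ... | a , a≈eₙ = 1≉0 (F.trans (F.sym (RingProperties.-‿involutive ring 1#))
        (F.trans (F.-‿cong -1≈0) (RingProperties.-0#≈0# ring)))
        where
        vanishes : linearCombination {suc n} (extend n a (- 1#) ∘ toℕ) (e ∘ toℕ) ≈ᴹ 0ᴹ
        vanishes = ≈ᴹ-trans (combination-extend n a (- 1#))
          (≈ᴹ-trans (+ᴹ-cong (≈ᴹ-trans a≈eₙ (≈ᴹ-sym (*ₗ-identityˡ _))) ≈ᴹ-refl)
            (≈ᴹ-trans (+ᴹ-comm _ _) (*ₗ-cancel 1# (e n))))

        -1≈0 : - 1# ≈ 0#
        -1≈0 = F.trans
          (F.reflexive (sym (trans (cong (extend n a (- 1#)) (Fin.toℕ-fromℕ n)) (extend-≡ n a (- 1#)))))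
          (independent (suc n) (extend n a (- 1#) ∘ toℕ) vanishes (Fin.fromℕ n))

      basis-infiniteDimensional : IsInfiniteDimensionalSubspace (Span (λ v → ∃[ n ] v ≡ e n))
      basis-infiniteDimensional =
        independent⇒infiniteDimensional e (applyDownFrom e) (∈-applyDownFrom⁺ e) basis∉initial

      module Enumeration (countable : Countable setoid U) where
        private
          decode : ℕ × ℕ → Carrierᴹ
          decode (l , k) =
            linearCombination {l} (proj₁ countable ∘ unpairSequence k ∘ toℕ) (e ∘ toℕ)

        vector : ℕ → Carrierᴹ
        vector = decode ∘ unpair

        vector-onto : ∀ v → ∃[ n ] vector n ≈ᴹ v
        vector-onto v with spanning v
        ... | l , a , a≈v with unpairSequence-surjective (λ k → proj₁ (proj₂ countable (a k) tt))
        ... | k , eq with unpair-surjective l k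
        ... | n , eqₙ = n , ≈ᴹ-trans (≈ᴹ-reflexive (cong decode eqₙ)) (≈ᴹ-trans
          (MonoidSum.sum-cong-≋ +ᴹ-monoid λ j → *ₗ-congʳ
            (F.trans (F.reflexive (cong (proj₁ countable) (eq j)))
                     (proj₂ (proj₂ countable (a j) tt))))
          a≈v)

        e₀≉0 : ¬ e 0 ≈ᴹ 0ᴹ
        e₀≉0 e₀≈0 = basis∉initial 0 (respects (≈ᴹ-sym e₀≈0) zeroᴹ)

        -- Occurrences of the zero vector in the enumeration are replaced by `e 0`.
        nonzero : ℕ → Setoid.Carrier E∖0
        nonzero n with em {P = vector n ≈ᴹ 0ᴹ}
        ... | yes _  = e 0 , e₀≉0
        ... | no  ≉0 = vector n , ≉0

        nonzero-onto : ∀ v → ∃[ n ] (proj₁ (nonzero n) ≈ᴹ proj₁ v)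
        nonzero-onto (v , v≉0) with vector-onto v
        ... | n , eq = n , nonzeroₙ
          where
          nonzeroₙ : proj₁ (nonzero n) ≈ᴹ v
          nonzeroₙ with em {P = vector n ≈ᴹ 0ᴹ}
          ... | yes ≈0 = contradiction (≈ᴹ-trans (≈ᴹ-sym eq) ≈0) v≉0
          ... | no  _  = eq

    -- Avoidance and its decision.

    module Dichotomy
      {vector : ℕ → Carrierᴹ} (vector-onto : ∀ v → ∃[ n ] vector n ≈ᴹ v)
      {nonzero : ℕ → Setoid.Carrier E∖0} (nonzero-onto : ∀ v → ∃[ n ] Setoid._≈_ E∖0 (nonzero n) v)
      (p : Level)
      where
      open Enumerated E∖0 Bool nonzero nonzero-onto
      open NonemptyPerfect

      InfiniteDimensional : Pred (Pred Carrierᴹ p) _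
      InfiniteDimensional = IsInfiniteDimensionalSubspace

      infixr 6 _⊕_
      -- The finite-dimensional summand is given by a list of indices, so that `unpairList` runs
      -- through all of them.
      _⊕_ : List ℕ → Pred Carrierᴹ p → Pred Carrierᴹ _
      X ⊕ W = Span (List.map vector X ∪ᵍ W)

      Avoidable : List ℕ → Pred Carrierᴹ p → Pred Point 0ℓ → Set _
      Avoidable X V P = Σ (Pred Carrierᴹ p) λ W → W ∈ InfiniteDimensional × W ⊆ V ×
                        ∃[ A ] (A ∈ P × Disjoint (X ⊕ W) A)

      HereditarilyAvoidable : List ℕ → Pred Carrierᴹ p → Pred Point 0ℓ → Set _
      HereditarilyAvoidable X V P =
        ∀ {V′} → V′ ∈ InfiniteDimensional → V′ ⊆ V →
        ∀ {P′} → NonemptyPerfect P′ → P′ ⊆ P → Avoidable X V′ P′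

      -- `inj₁` says that no further space and perfect set reach the situation of `inj₂`. Both cases
      -- persist when the space or the set shrinks.
      Decided : List ℕ → Pred Carrierᴹ p → Pred Point 0ℓ → Set _
      Decided X V P = HereditarilyAvoidable X V P ⊎ ¬ Avoidable X V P

      disjoint-⊆ : ∀ {V : Pred Carrierᴹ q} {W : Pred Carrierᴹ q′} {A} →
                   W ⊆ V → Disjoint V A → Disjoint W A
      disjoint-⊆ W⊆V disjoint v v∈W = disjoint v (W⊆V v∈W)

      ⊕-mono : ∀ X {V W} → V ⊆ W → X ⊕ V ⊆ X ⊕ W
      ⊕-mono X V⊆W = span-mono λ { (inj₁ x∈) → inj₁ x∈ ; (inj₂ v∈) → inj₂ (V⊆W v∈) }

      decided-⊆ : ∀ {X V P Q} → Q ⊆ P → Decided X V P → Decided X V Q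
      decided-⊆ Q⊆P (inj₁ good) = inj₁ λ V′∞ V′⊆V perf P′⊆Q → good V′∞ V′⊆V perf (Q⊆P ∘ P′⊆Q)
      decided-⊆ Q⊆P (inj₂ bad)  = inj₂ λ (W , W∞ , W⊆V , A , A∈ , disjoint) →
        bad (W , W∞ , W⊆V , A , Q⊆P A∈ , disjoint)

      decided-good : ∀ {X V P} → Decided X V P → Avoidable X V P → HereditarilyAvoidable X V P
      decided-good (inj₁ good) _         = good
      decided-good (inj₂ bad)  avoidable = contradiction avoidable bad

      -- Holds when V is contained in U up to finite dimension.
      _⊆*_ : Pred Carrierᴹ p → Pred Carrierᴹ p → Set _
      V ⊆* U = ∀ {W} → W ∈ InfiniteDimensional → W ⊆ V → (W ∩ᵛ U) ∈ InfiniteDimensional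

      ⊆⇒⊆* : ∀ {U V} → V ⊆ U → V ⊆* U
      ⊆⇒⊆* V⊆U W∞ W⊆V = infiniteDimensional-≐ (λ w∈ → w∈ , V⊆U (W⊆V w∈)) proj₁ W∞

      -- Finite-dimensional differences do not matter: each subspace of `V` concerned is replaced by
      -- its intersection with `U`, which is still infinite-dimensional.
      decided-⊆* : ∀ {X U V P} → V ⊆* U → Decided X U P → Decided X V P
      decided-⊆* V⊆*U (inj₁ good) = inj₁ λ V′∞ V′⊆V perf P′⊆P →
        let W , W∞ , W⊆ , avoided = good (V⊆*U V′∞ V′⊆V) proj₂ perf P′⊆P
        in W , W∞ , proj₁ ∘ W⊆ , avoided
      decided-⊆* {X} {U} V⊆*U (inj₂ bad) = inj₂ λ (W , W∞ , W⊆V , A , A∈ , disjoint) →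
        bad (W ∩ᵛ U , V⊆*U W∞ W⊆V , proj₂ , A , A∈
               , disjoint-⊆ {A = A} (⊕-mono X {W ∩ᵛ U} {W} proj₁) disjoint)

      record Decision (X : List ℕ) {n} (V : Pred Carrierᴹ p) (P : Vec Bool n → Pred Point 0ℓ)
             : Set (c ⊔ˡ ℓ ⊔ˡ μ ⊔ˡ ℓμ ⊔ˡ sucˡ p ⊔ˡ sucˡ 0ℓ) where
        field
          V′      : Pred Carrierᴹ p
          V′∞     : V′ ∈ InfiniteDimensional
          V′⊆V    : V′ ⊆ V
          P′      : Vec Bool n → Pred Point 0ℓ
          perfect : ∀ t → NonemptyPerfect (P′ t)
          P′⊆P    : ∀ t → P′ t ⊆ P t
          decided : ∀ t → Decided X V′ (P′ t)

      -- All nodes of a level are decided with one common space. The half under `false` is treated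
      -- inside the space obtained for the half under `true`, whose decisions survive the shrinking.
      decide : ∀ X {n} {V} {P : Vec Bool n → Pred Point 0ℓ} → V ∈ InfiniteDimensional →
               (∀ t → NonemptyPerfect (P t)) → Decision X V P
      decide X {zero} {V} {P} V∞ perf
        with em {P = Σ (Pred Carrierᴹ p) λ V′ → V′ ∈ InfiniteDimensional × V′ ⊆ V ×
                     Σ (Pred Point 0ℓ) λ P′ → NonemptyPerfect P′ × P′ ⊆ P [] × ¬ Avoidable X V′ P′}
      ... | yes (V′ , V′∞ , V′⊆V , P′ , perf′ , P′⊆P , bad) = record
        { V′ = V′ ; V′∞ = V′∞ ; V′⊆V = V′⊆V ; P′ = λ _ → P′ ; perfect = λ _ → perf′
        ; P′⊆P = λ { [] → P′⊆P } ; decided = λ _ → inj₂ bad }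
      ... | no none = record
        { V′ = V ; V′∞ = V∞ ; V′⊆V = id ; P′ = P ; perfect = perf
        ; P′⊆P = λ _ → id
        ; decided = λ { [] → inj₁ λ V′∞ V′⊆V perf′ P′⊆P →
            dne λ bad → none (_ , V′∞ , V′⊆V , _ , perf′ , P′⊆P , bad) } }
      decide X {suc n} V∞ perf = record
        { V′      = D₂.V′
        ; V′∞     = D₂.V′∞
        ; V′⊆V    = D₁.V′⊆V ∘ D₂.V′⊆V
        ; P′      = λ { (true ∷ t) → D₁.P′ t ; (false ∷ t) → D₂.P′ t }
        ; perfect = λ { (true ∷ t) → D₁.perfect t ; (false ∷ t) → D₂.perfect t }
        ; P′⊆P    = λ { (true ∷ t) → D₁.P′⊆P t ; (false ∷ t) → D₂.P′⊆P t }
        ; decided = λ { (true ∷ t) → decided-⊆* (⊆⇒⊆* D₂.V′⊆V) (D₁.decided t)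
                      ; (false ∷ t) → D₂.decided t }
        }
        where
        module D₁ = Decision (decide X V∞ (λ t → perf (true ∷ t)))
        module D₂ = Decision (decide X D₁.V′∞ (λ t → perf (false ∷ t)))

      -- Fusion: one space and one perfect set deciding every `X`.

      module Fusion {V₀ : Pred Carrierᴹ p} (V₀∞ : V₀ ∈ InfiniteDimensional)
                    {P₀ : Pred Point 0ℓ} (P₀-perfect : NonemptyPerfect P₀) where

        -- `ws` holds the vectors chosen so far; all later ones come from `V`.
        record Stage (n : ℕ) : Set (c ⊔ˡ ℓ ⊔ˡ μ ⊔ˡ ℓμ ⊔ˡ sucˡ p ⊔ˡ sucˡ 0ℓ) where
          field
            V       : Pred Carrierᴹ p
            V∞      : V ∈ InfiniteDimensional
            ws      : List Carrierᴹ
            P       : Vec Bool n → Pred Point 0ℓ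
            perfect : ∀ t → NonemptyPerfect (P t)
            depth   : Vec Bool n → ℕ
            in-cell : ∀ t {y} → y ∈ P t → centre (perfect t) ≈⟨ depth t ⟩ y

        initial : Stage 0
        initial = record
          { V       = V₀
          ; V∞      = V₀∞
          ; ws      = []
          ; P       = λ _ → P₀
          ; perfect = λ _ → P₀-perfect
          ; depth   = λ _ → 0
          ; in-cell = λ _ _ → agree λ _ ()
          }

        module _ {n} (s : Stage n) where
          open Stage s

          escaping : ∃[ w ] (w ∈ V × ¬ w ∈ Span (_∈ₗ ws))
          escaping = escape V∞ ws

          decision : Decision (unpairList n) V P
          decision = decide (unpairList n) V∞ perfect

          open module D = Decision decision using (V′; V′∞; P′)

          splitting : ∀ t → Splitting (P′ t)
          splitting t = perfect-splits (D.perfect t)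

          splitDepth : Vec Bool n → ℕ
          splitDepth t = suc (depth t ⊔ proj₁ (proj₂ (proj₂ (splitting t))))

          next : Stage (suc n)
          next = record
            { V       = V′
            ; V∞      = V′∞
            ; ws      = proj₁ escaping ∷ ws
            ; P       = λ { (b ∷ t) → P′ t ∩[ proj₁ (splitting t) b , splitDepth t ] }
            ; perfect = λ { (b ∷ t) →
                ∩-perfect (D.perfect t) (proj₁ (proj₂ (splitting t)) b) (splitDepth t) }
            ; depth   = λ { (b ∷ t) → splitDepth t }
            ; in-cell = λ { (b ∷ t) → proj₂ }
            }

        stage : ∀ n → Stage n
        stage zero    = initial
        stage (suc n) = next (stage n)

        open module S n = Stage (stage n) using (V; V∞; ws; P; perfect; depth; in-cell)

        w : ℕ → Carrierᴹ
        w n = proj₁ (escaping (stage n))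

        w∈ws : ∀ {i n} → suc i ≤′ n → w i ∈ₗ ws n
        w∈ws ≤′-refl       = here refl
        w∈ws (≤′-step i<n) = there (w∈ws i<n)

        V-antitone : ∀ {k n} → k ≤′ n → V n ⊆ V k
        V-antitone ≤′-refl       = id
        V-antitone (≤′-step {n} k≤n) = V-antitone k≤n ∘ Decision.V′⊆V (decision (stage n))

        P-tail : ∀ {n} b (t : Vec Bool n) → P (suc n) (b ∷ t) ⊆ P n t
        P-tail {n} b t (y∈ , _) = Decision.P′⊆P (decision (stage n)) t y∈

        P-ancestor : ∀ {k n} (k≤n : k ≤′ n) t → P n t ⊆ P k (ancestor k≤n t)
        P-ancestor ≤′-refl       t       = id
        P-ancestor (≤′-step k≤n) (b ∷ t) = P-ancestor k≤n t ∘ P-tail b t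

        scheme : CantorScheme
        scheme = record
          { centre  = λ {n} t → centre (perfect n t)
          ; depth   = λ {n} → depth n
          ; deepens = λ {n} b t → s≤s (m≤m⊔n (depth n t) _)
          ; refines = λ {n} b t → in-cell n t (P-tail b t (centre∈ (perfect (suc n) (b ∷ t))))
          ; splits  = λ {n} t → let _ , _ , j , apart = splitting (stage n) t in
                                j , (λ _ → s≤s (m≤n⊔m (depth n t) j)) , apart
          }

        open CantorScheme scheme public using (Cell; Body; body-perfect; approximate)

        -- Cells only fix coordinates, so membership in `P n t` comes from closedness: the centres
        -- of descendants of `t` lie in `P n t` and approximate `y`.
        body∩cell⊆P : ∀ {n} (t : Vec Bool n) {y} → y ∈ Body → y ∈ Cell t → y ∈ P n t
        body∩cell⊆P {n} t {y} y∈ y∈t = closed (perfect n t) y near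
          where
          near : ∀ N → ∃[ x ] (x ∈ P n t × y ≈⟨ N ⟩ x)
          near N with approximate {t = t} y∈ y∈t N
          ... | k , n≤k , u , refl , y≈ =
            _ , P-ancestor n≤k u (centre∈ (perfect k u)) , y≈

        body⊆P₀ : Body ⊆ P₀
        body⊆P₀ y∈ = body∩cell⊆P [] y∈ (agree λ _ ())

        Vω : Pred Carrierᴹ p
        Vω = Resized p ∘ Span (λ v → ∃[ n ] v ≡ w n)

        Vω∞ : Vω ∈ InfiniteDimensional
        Vω∞ = infiniteDimensional-≐ resize unresize
          (independent⇒infiniteDimensional w ws (w∈ws ∘ ≤⇒≤′)
            (λ n → proj₂ (proj₂ (escaping (stage n)))))

        -- The generators `w k` with `k ≥ n` lie in `V n`, and the finitely many others are listed
        -- in `ws n`.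
        Vω⊆*V : ∀ n → Vω ⊆* V n
        Vω⊆*V n W∞ W⊆Vω = ∩-infiniteDimensional (ws n) W∞ (isSubspace (V∞ n))
          λ x∈ → span-least (span-isSubspace _) generators (unresize (W⊆Vω x∈))
          where
          generators : ∀ {v} → ∃[ k ] v ≡ w k → v ∈ Span (ws n ∪ᵍ V n)
          generators (k , refl) with k <? n
          ... | yes k<n = generator (inj₁ (w∈ws (≤⇒≤′ k<n)))
          ... | no  k≮n = generator (inj₂
            (V-antitone (≤⇒≤′ (≮⇒≥ k≮n)) (proj₁ (proj₂ (escaping (stage k))))))

        -- `X` is treated at the stage `n` that codes it. The decision there holds on the set of the
        -- node `t`, hence on the part of the body in the cell of its child `b ∷ t`, and passes from
        -- `V (suc n)` to `Vω`.
        body-decided : ∀ X {A} → A ∈ Body → ∃[ N ] Decided X Vω (Body ∩[ A , N ])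
        body-decided X A∈ with unpairList-surjective X
        ... | n , refl with A∈ (suc n)
        ... | b ∷ t , A∈bt = depth (suc n) (b ∷ t)
          , decided-⊆ (λ (y∈ , A≈y) → body∩cell⊆P (b ∷ t) y∈ (≈⟨⟩-trans A∈bt A≈y))
              (decided-⊆ proj₁ (decided-⊆* (Vω⊆*V (suc n))
                (Decision.decided (decision (stage n)) t)))

      -- A Cantor scheme avoiding the span of selected vectors.

      avoidAll : ∀ {X V V′ n} (Q : Vec Bool n → Pred Point 0ℓ) → (∀ t → NonemptyPerfect (Q t)) →
                 (∀ t → HereditarilyAvoidable X V (Q t)) → V′ ∈ InfiniteDimensional → V′ ⊆ V →
                 Σ (Pred Carrierᴹ p) λ W → W ∈ InfiniteDimensional × W ⊆ V′ ×
                 Σ (Vec Bool n → Point) λ A → (∀ t → A t ∈ Q t) × (∀ t → Disjoint (X ⊕ W) (A t))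
      avoidAll {n = zero} Q perf good V′∞ V′⊆V with good [] V′∞ V′⊆V (perf []) id
      ... | W , W∞ , W⊆ , A , A∈ , disjoint =
        W , W∞ , W⊆ , (λ _ → A) , (λ { [] → A∈ }) , λ _ → disjoint
      -- The second half is served inside `W₁`. Points found for the first half avoid `X ⊕ W₁`,
      -- hence also the smaller `X ⊕ W₂`.
      avoidAll {X} {n = suc n} Q perf good V′∞ V′⊆V
        with avoidAll (Q ∘ (true ∷_)) (perf ∘ (true ∷_)) (λ t → good (true ∷ t)) V′∞ V′⊆V
      ... | W₁ , W₁∞ , W₁⊆ , A₁ , A₁∈ , disjoint₁
        with avoidAll (Q ∘ (false ∷_)) (perf ∘ (false ∷_)) (λ t → good (false ∷ t)) W₁∞ (V′⊆V ∘ W₁⊆)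
      ... | W₂ , W₂∞ , W₂⊆ , A₂ , A₂∈ , disjoint₂ = W₂ , W₂∞ , W₁⊆ ∘ W₂⊆
        , (λ { (true ∷ t) → A₁ t ; (false ∷ t) → A₂ t })
        , (λ { (true ∷ t) → A₁∈ t ; (false ∷ t) → A₂∈ t })
        , (λ { (true ∷ t) → disjoint-⊆ {A = A₁ t} (⊕-mono X {W₂} {W₁} W₂⊆) (disjoint₁ t)
             ; (false ∷ t) → disjoint₂ t })

      module Selection
        {P : Pred Point 0ℓ} (P-perfect : NonemptyPerfect P)
        {V : Pred Carrierᴹ p} (V∞ : V ∈ InfiniteDimensional)
        (P-decided : ∀ X {A} → A ∈ P → ∃[ N ] Decided X V (P ∩[ A , N ]))
        {A₀ : Point} (A₀∈ : A₀ ∈ P) {N₀ : ℕ} (good₀ : HereditarilyAvoidable [] V (P ∩[ A₀ , N₀ ]))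
        where

        -- `V` stays fixed here, since the fusion has decided every `X` below it; only the list and
        -- the points change.
        record Stage (n : ℕ) : Set (c ⊔ˡ ℓ ⊔ˡ μ ⊔ˡ ℓμ ⊔ˡ sucˡ p ⊔ˡ sucˡ 0ℓ) where
          field
            X     : List ℕ
            A     : Vec Bool n → Point
            A∈    : ∀ t → A t ∈ P
            depth : Vec Bool n → ℕ
            good  : ∀ t → HereditarilyAvoidable X V (P ∩[ A t , depth t ])

        module _ {n} (s : Stage n) where
          open Stage s

          splitting : ∀ t → Splitting (P ∩[ A t , depth t ])
          splitting t = perfect-splits (∩-perfect P-perfect (A∈ t) (depth t))

          splitPoint : Vec Bool (suc n) → Point
          splitPoint (b ∷ t) = proj₁ (splitting t) b

          splitPoint∈ : ∀ b t → splitPoint (b ∷ t) ∈ P ∩[ A t , depth t ]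
          splitPoint∈ b t = proj₁ (proj₂ (splitting t)) b

          splitDepth : Vec Bool n → ℕ
          splitDepth t = suc (depth t ⊔ proj₁ (proj₂ (proj₂ (splitting t))))

          depth≤splitDepth : ∀ t → depth t ≤ splitDepth t
          depth≤splitDepth t = m≤n⇒m≤1+n (m≤m⊔n (depth t) _)

          Part : Vec Bool (suc n) → Pred Point 0ℓ
          Part (b ∷ t) = P ∩[ splitPoint (b ∷ t) , splitDepth t ]

          Part-perfect : ∀ t → NonemptyPerfect (Part t)
          Part-perfect (b ∷ t) = ∩-perfect P-perfect (proj₁ (splitPoint∈ b t)) (splitDepth t)

          Part-good : ∀ t → HereditarilyAvoidable X V (Part t)
          Part-good (b ∷ t) V′∞ V′⊆V perf P′⊆ = good t V′∞ V′⊆V perf λ y∈ →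
            let y∈P , y≈ = P′⊆ y∈ in
            y∈P , ≈⟨⟩-trans (proj₂ (splitPoint∈ b t)) (≈⟨⟩-mono (depth≤splitDepth t) y≈)

          avoiding = avoidAll {X} Part Part-perfect Part-good V∞ id

          W : Pred Carrierᴹ p
          W = proj₁ avoiding

          W∞ : W ∈ InfiniteDimensional
          W∞ = proj₁ (proj₂ avoiding)

          B : Vec Bool (suc n) → Point
          B = proj₁ (proj₂ (proj₂ (proj₂ avoiding)))

          B∈ : ∀ t → B t ∈ Part t
          B∈ = proj₁ (proj₂ (proj₂ (proj₂ (proj₂ avoiding))))

          B-disjoint : ∀ t → Disjoint (X ⊕ W) (B t)
          B-disjoint = proj₂ (proj₂ (proj₂ (proj₂ (proj₂ avoiding))))

          selected : ∃[ j ] (vector j ∈ W × ¬ vector j ∈ Span (_∈ₗ List.map vector X))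
          selected with escape W∞ (List.map vector X)
          -- `X` lists indices, so the vector is exchanged for an equal one of the enumeration.
          ... | v , v∈W , v∉ with vector-onto v
          ... | j , eq = j , IsSubspace.resp (isSubspace W∞) (≈ᴹ-sym eq) v∈W , v∉ ∘ respects eq

          X′ : List ℕ
          X′ = proj₁ selected ∷ X

          -- The new vector was taken from `W`, so the points `B t`, which avoid `X ⊕ W`, also avoid
          -- the enlarged space.
          X′⊕W⊆X⊕W : X′ ⊕ W ⊆ X ⊕ W
          X′⊕W⊆X⊕W = span-least (span-isSubspace _) λ where
            (inj₁ (here refl)) → generator (inj₂ (proj₁ (proj₂ selected)))
            (inj₁ (there x∈))  → generator (inj₁ x∈)
            (inj₂ w∈)          → generator (inj₂ w∈)

          X′-disjoint : ∀ t → Disjoint (Span (_∈ₗ List.map vector X′)) (B t)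
          X′-disjoint t = disjoint-⊆ {A = B t} (X′⊕W⊆X⊕W ∘ span-mono inj₁) (B-disjoint t)

          B∈P : ∀ t → B t ∈ P
          B∈P (b ∷ t) = proj₁ (B∈ (b ∷ t))

          -- `X′` is decided near `B t`, and `W` together with `B t` itself refutes the negative
          -- case.
          B-good : ∀ t → HereditarilyAvoidable X′ V (P ∩[ B t , proj₁ (P-decided X′ (B∈P t)) ])
          B-good t = decided-good {X′} (proj₂ (P-decided X′ (B∈P t)))
            (W , W∞ , proj₁ (proj₂ (proj₂ avoiding)) , B t , (B∈P t , ≈⟨⟩-refl)
               , disjoint-⊆ {A = B t} X′⊕W⊆X⊕W (B-disjoint t))

          nextDepth : Vec Bool (suc n) → ℕ
          nextDepth (b ∷ t) = splitDepth t ⊔ proj₁ (P-decided X′ (B∈P (b ∷ t)))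

          splitDepth≤nextDepth : ∀ b t → splitDepth t ≤ nextDepth (b ∷ t)
          splitDepth≤nextDepth b t = m≤m⊔n (splitDepth t) (proj₁ (P-decided X′ (B∈P (b ∷ t))))

          next : Stage (suc n)
          next = record
            { X     = X′
            ; A     = B
            ; A∈    = B∈P
            ; depth = nextDepth
            ; good  = λ { (b ∷ t) V′∞ V′⊆V perf P′⊆ → B-good (b ∷ t) V′∞ V′⊆V perf λ y∈ →
                let y∈P , y≈ = P′⊆ y∈ in y∈P , ≈⟨⟩-mono (m≤n⊔m (splitDepth t) _) y≈ }
            }

        stage : ∀ n → Stage n
        stage zero    = record
          { X = [] ; A = λ _ → A₀ ; A∈ = λ _ → A₀∈ ; depth = λ _ → N₀ ; good = λ _ → good₀ }
        stage (suc n) = next (stage n)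

        open module S n = Stage (stage n) using (X; A; A∈; depth)

        scheme : CantorScheme
        scheme = record
          { centre  = λ {n} → A n
          ; depth   = λ {n} → depth n
          ; deepens = λ {n} b t →
              ≤-trans (s≤s (m≤m⊔n (depth n t) _)) (splitDepth≤nextDepth (stage n) b t)
          ; refines = λ {n} b t → ≈⟨⟩-trans (proj₂ (splitPoint∈ (stage n) b t))
              (≈⟨⟩-mono (depth≤splitDepth (stage n) t) (proj₂ (B∈ (stage n) (b ∷ t))))
          ; splits  = λ {n} t → let j , apart = proj₂ (proj₂ (splitting (stage n) t)) in
              j , (λ b → ≤-trans (s≤s (m≤n⊔m (depth n t) j)) (splitDepth≤nextDepth (stage n) b t))
                , λ eq → apart (trans
                    (at (proj₂ (B∈ (stage n) (true ∷ t))) j (s≤s (m≤n⊔m (depth n t) j)))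
                    (trans eq (sym (at (proj₂ (B∈ (stage n) (false ∷ t))) j (s≤s (m≤n⊔m (depth n t) j))))))
          }

        open CantorScheme scheme public using (Body; body-perfect; n≤depth)

        body⊆P : Body ⊆ P
        body⊆P {y} y∈ = closed P-perfect y λ N → let t , y∈t = y∈ N in
          A N t , A∈ N t , ≈⟨⟩-sym (≈⟨⟩-mono (n≤depth t) y∈t)

        x : ℕ → ℕ
        x n = proj₁ (selected (stage n))

        x∈X : ∀ {i n} → suc i ≤′ n → vector (x i) ∈ₗ List.map vector (X n)
        x∈X ≤′-refl       = here refl
        x∈X (≤′-step i<n) = there (x∈X i<n)

        Vω : Pred Carrierᴹ p
        Vω = Resized p ∘ Span (λ v → ∃[ n ] v ≡ vector (x n))

        Vω∞ : Vω ∈ InfiniteDimensional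
        Vω∞ = infiniteDimensional-≐ resize unresize
          (independent⇒infiniteDimensional (vector ∘ x) (List.map vector ∘ X) (x∈X ∘ ≤⇒≤′)
            (λ n → proj₂ (proj₂ (selected (stage n)))))

        -- Only finitely many selected vectors enter `v`. At a level beyond these and beyond `# v`,
        -- the point of the node avoids their span and has the same value at `v` as `y`.
        body-disjoint : ∀ y → y ∈ Body → Disjoint Vω y
        body-disjoint y y∈ v v∈ =
          trans (sym (≈⟨⟩⇒≡ {x = A (suc n) t} {y} v #v<depth (proj₂ (y∈ (suc n)))))
            (X′-disjoint (stage n) t v v∈X)
          where
          compact : ∃[ k ] v .proj₁ ∈ Span (Below (vector ∘ x) k)
          compact = span-range-compact (vector ∘ x) (unresize v∈)

          n : ℕ
          n = proj₁ compact ⊔ # v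

          t : Vec Bool (suc n)
          t = proj₁ (y∈ (suc n))

          #v<depth : # v < depth (suc n) t
          #v<depth = ≤-trans (s≤s (m≤n⊔m (proj₁ compact) (# v))) (n≤depth t)

          v∈X : v .proj₁ ∈ Span (_∈ₗ List.map vector (X (suc n)))
          v∈X = span-mono
            (λ { (i , i<k , refl) →
                 x∈X (≤⇒≤′ (≤-trans i<k (m≤n⇒m≤1+n (m≤m⊔n (proj₁ compact) (# v))))) })
            (proj₂ compact)

      -- The alternative for perfect families.

      dichotomy : ∀ {V₀} → V₀ ∈ InfiniteDimensional →
        ∀ {P₀ : Pred Point 0ℓ} → NonemptyPerfect P₀ →
        Σ (Pred Point 0ℓ) λ P → NonemptyPerfect P × P ⊆ P₀ ×
        Σ (Pred Carrierᴹ p) λ V → V ∈ InfiniteDimensional ×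
        ((∀ A → A ∈ P → Disjoint V A) ⊎ (∀ A → A ∈ P → AsymptoticBelow A V))
      dichotomy V₀∞ P₀-perfect =
        -- The case of `X = []` near a single point of the fused body settles which alternative is
        -- obtained.
        [ avoiding , meeting ]′ (proj₂ (body-decided [] (centre∈ body-perfect)))
        where
        open Fusion V₀∞ P₀-perfect

        A₀ = centre body-perfect
        N₀ = proj₁ (body-decided [] (centre∈ body-perfect))

        Conclusion : Set _
        Conclusion = Σ (Pred Point 0ℓ) λ P → NonemptyPerfect P × P ⊆ _ ×
          Σ (Pred Carrierᴹ p) λ V → V ∈ InfiniteDimensional ×
          ((∀ A → A ∈ P → Disjoint V A) ⊎ (∀ A → A ∈ P → AsymptoticBelow A V))

        avoiding : HereditarilyAvoidable [] Vω (Body ∩[ A₀ , N₀ ]) → Conclusion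
        avoiding good = Sel.Body , Sel.body-perfect , body⊆P₀ ∘ Sel.body⊆P
          , Sel.Vω , Sel.Vω∞ , inj₁ Sel.body-disjoint
          where
          module Sel = Selection body-perfect Vω∞ body-decided (centre∈ body-perfect) good

        meeting : ¬ Avoidable [] Vω (Body ∩[ A₀ , N₀ ]) → Conclusion
        meeting bad = Body ∩[ A₀ , N₀ ] , ∩-perfect body-perfect (centre∈ body-perfect) N₀
          , body⊆P₀ ∘ proj₁ , Vω , Vω∞ , inj₂ meets
          where
          meets : ∀ A → A ∈ Body ∩[ A₀ , N₀ ] → AsymptoticBelow A Vω
          -- A `W` missed by `A` would make `[]` avoidable, because `[] ⊕ W` is `W` again.
          meets A A∈ W W∞ W⊆V = dne λ none → bad (W , W∞ , W⊆V , A , A∈ , disjoint none)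
            where
            disjoint : ¬ Meets W A → Disjoint ([] ⊕ W) A
            disjoint none v v∈ with A ⟨$⟩ v in eq
            ... | false = refl
            ... | true  = contradiction
              (v , span-least (isSubspace W∞) (λ { (inj₂ w∈) → w∈ }) v∈ , eq) none

theorem2p3 : (∀ {k} → ExcludedMiddle k) →
    ∀ {c ℓ m ℓm a p}
    (F : CommutativeRing c ℓ) → IsField F →
    Countable (CommutativeRing.setoid F) U →
    (E : Module F m ℓm) (e : ℕ → Module.Carrierᴹ E) →
    let open VectorSpace E in
    IsBasis e →
    (𝒜 : Pred Point a) → Analytic 𝒜 → ¬ Countable pointSetoid 𝒜 →
    Σ (Pred Point a) λ 𝒫 →
    Σ (Pred (Module.Carrierᴹ E) p) λ V →
    Satisfiable 𝒫 × Perfect 𝒫 × 𝒫 ⊆ 𝒜 ×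
    IsInfiniteDimensionalSubspace V ×
    ((∀ A → A ∈ 𝒫 → Disjoint V A) ⊎ (∀ A → A ∈ 𝒫 → AsymptoticBelow A V))
theorem2p3 em F isField countable E e basis 𝒜 (inj₁ empty) uncountable =
  contradiction
    -- A constant sequence, at the empty subset, enumerates the empty family.
    ( (λ _ → record { to = λ _ → false ; cong = λ _ → refl })
    , λ A A∈ → contradiction A∈ (empty A))
    uncountable
theorem2p3 em {a = a} {p} F isField countable E e basis 𝒜 (inj₂ (f , f-cont , image)) uncountable =
  let P₀ , P₀-perfect , P₀⊆range = perfectSubset
      P , P-perfect , P⊆P₀ , V , V∞ , alternative =
        -- The starting space is the span of the basis, moved to level `p`.
        dichotomy (infiniteDimensional-≐ resize unresize (basis-infiniteDimensional basis)) P₀-perfect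
  in Lift a ∘ P , V
     , (NonemptyPerfect.centre P-perfect , lift (NonemptyPerfect.centre∈ P-perfect))
     , nonemptyPerfect⇒perfect nonzero-onto (nonemptyPerfect-≐ lift lower P-perfect)
     , (λ {A} A∈ → Equivalence.from (image A) (P₀⊆range A (P⊆P₀ (lower A∈))))
     , V∞
     , Sum.map (λ disjoint A A∈ → disjoint A (lower A∈))
               (λ asymptotic A A∈ → asymptotic A (lower A∈)) alternative
  where
  open Classical em
  open LinearAlgebra isField E
  open Enumeration basis countable
  open Dichotomy vector-onto nonzero-onto p using (dichotomy)
  open Enumerated (VectorSpace.E∖0 E) Bool nonzero nonzero-onto

  f-uncountable : ¬ (Σ (ℕ → VectorSpace.Point E) λ g → ∀ z → ∃[ n ] (VectorSpace._≈ₚ_ E (g n) (f z)))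
  f-uncountable (g , covers) = uncountable (g , λ A A∈ →
    let z , fz≈A = Equivalence.to (image A) A∈
        n , gₙ≈fz = covers z
    in n , λ v → trans (gₙ≈fz v) (fz≈A v))

  open PerfectSet nonzero-onto f f-cont f-uncountable using (perfectSubset)
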